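{- Fix integers $m\ge 2$ and $c\ge 1$. There exist constants $C,s_0>0$ depending only on $m,c$ such that for all integers $s\ge s_0$, with $n=ms+c$ and $\ell=s-c$, every shifted family $\mathcal F\subset 2^{[n]}$ with $\nu(\mathcal F)<s$ satisfies \[ y_{\mathcal F}(m)+y_{\mathcal F}(m+1)\ge (2c+2)\binom{n}{m-1}-Cs^{m-2} \] provided one of the following holds: \begin{enumerate} \item $c\ge 2$ and $\mathcal F\not\subseteq\mathcal Q(m,s,\ell)$; \item $c=1$, $\mathcal F\not\subseteq\mathcal Q(m,s,\ell)$ and $\mathcal F\not\subseteq\mathcal W(m,s,\ell)$. \end{enumerate}
   Context: $[b]=\{1,\dots,b\}$. $\nu(\mathcal F)$ is the maximum number of pairwise disjoint sets in $\mathcal F$. For $\mathcal F\subset 2^{[n]}$, $y_{\mathcal F}(i)=\binom{n}{i}-|\mathcal F\cap\binom{[n]}{i}|$. $\mathcal Q(m,s,\ell)=\{P\subset[n]:|P|+|P\cap[ms-c-1]|\ge 2m\}$ and $\mathcal W(m,s,\ell)=\{P\subset[n]:|P\cap[ms-1]|\ge m\}$. Writing a set as $(a_1,\dots,a_k)$ with $a_1<\dots<a_k$, $(a_1,\dots,a_k)$ can be shifted to $(b_1,\dots,b_k)$ if $a_i\ge b_i$ for all $i$; a family is shifted if it is closed under this operation. (The paper writes the error term as $+O(s^{m-2})$ with $m,c$ fixed, $s\to\infty$.) -}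

module Defs where

open import Data.Nat using (ℕ; zero; suc; _+_; _*_; _∸_; _≤_; _<ᵇ_; _≡ᵇ_)
open import Data.Nat.Combinatorics using (_C_)
open import Data.Bool using (Bool; true; false; _∧_)
open import Data.Fin using (Fin; toℕ)
open import Data.Fin.Subset using (Subset; ∣_∣; _∩_; ⊥; inside; outside)
open import Data.Vec using (Vec; []; _∷_; tabulate)
open import Data.List using (List; []; _∷_; map; _++_; length; filterᵇ)
open import Data.List.Relation.Binary.Pointwise using (Pointwise)
open import Data.Product using (Σ; _×_)
open import Relation.Nullary using (¬_)
open import Relation.Binary.PropositionalEquality using (_≡_; _≢_)

-- Subsets of [n] = {1,…,n} are encoded as Subset n; position i : Fin n
-- stands for the element toℕ i + 1 of [n].

Family : ℕ → Set
Family n = Subset n → Bool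

_∈F_ : ∀ {n} → Subset n → Family n → Set
P ∈F F = F P ≡ true

allSubsets : (n : ℕ) → List (Subset n)
allSubsets zero = [] ∷ []
allSubsets (suc n) = map (inside ∷_) (allSubsets n) ++ map (outside ∷_) (allSubsets n)

seg : (n k : ℕ) → Subset n
seg n k = tabulate (λ i → toℕ i <ᵇ k)

y : ∀ {n} → Family n → ℕ → ℕ
y {n} F i = (n C i) ∸ length (filterᵇ (λ P → (∣ P ∣ ≡ᵇ i) ∧ F P) (allSubsets n))

elems : ∀ {n} → Subset n → List ℕ
elems [] = []
elems (true ∷ p) = 1 ∷ map suc (elems p)
elems (false ∷ p) = map suc (elems p)

ShiftsTo : ∀ {n} → Subset n → Subset n → Set
ShiftsTo A B = Pointwise (λ a b → b ≤ a) (elems A) (elems B)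

Shifted : ∀ {n} → Family n → Set
Shifted F = ∀ A B → A ∈F F → ShiftsTo A B → B ∈F F

HasMatching : ∀ {n} → Family n → ℕ → Set
HasMatching {n} F s =
  Σ (Fin s → Subset n) λ P →
    (∀ i → P i ∈F F) × (∀ i j → i ≢ j → (P i ∩ P j ≡ ⊥) × (P i ≢ P j))

νLess : ∀ {n} → Family n → ℕ → Set
νLess F s = ¬ HasMatching F s

InQ : ∀ {n} → (m s c : ℕ) → Subset n → Set
InQ {n} m s c P = 2 * m ≤ ∣ P ∣ + ∣ P ∩ seg n (m * s ∸ c ∸ 1) ∣

InW : ∀ {n} → (m s : ℕ) → Subset n → Set
InW {n} m s P = m ≤ ∣ P ∩ seg n (m * s ∸ 1) ∣

FamSub : ∀ {n} → Family n → (Subset n → Set) → Set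
FamSub F G = ∀ P → P ∈F F → G P

module Submission where

-- Write k = m - 1 and call an element of [n] of rank q if exactly q elements are larger. A shifted
-- family that contains sets B_1, …, B_s with at most t elements of [t] in total (with
-- multiplicity), for every t, has s pairwise disjoint members (shifted-matching).
-- Fix large constants J and L. Either some k-set A₀ ⊆ (k s + L, n - J] has a member A₀ ∪ {x} of F
-- with x of rank < J, or J·C(s + c - L - J, k) ≥ (2c + 2)·C(n, k) sets of size m are missing. In
-- the first case A₀ ∪ {x} can be repeated up to s times at almost no cost for the above condition,
-- and every k-set A ⊆ (L, n - J] then has at least 2c + 2 missing extensions by one or two elements
-- of rank < J. Indeed, let j be the first rank such that A plus the element of rank j is in F, and
-- complete J copies of this set by copies of A₀ ∪ {x}. This contradicts ν(F) < s if j ≤ c. For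
-- c < j ≤ 2c so it does together with j - c copies of A plus a pair of ranks a ≤ 2c - j and c; hence
-- 2c - j + 1 pairs are missing as well. For j ≤ 2c + 1 so it does together with a member outside Q
-- and copies of A plus the pair of ranks 0, 1; hence this pair is missing. The count is
-- j + (2c - j + 1) + 1 = 2c + 2 if c ≥ 2; when c = 1 the two pairs coincide and a member outside W
-- gives the contradiction for j ≤ 2.

open import Defs
open import Data.Nat using (ℕ; zero; suc; pred; _+_; _*_; _^_; _∸_; _≤_; _<_; _≡ᵇ_; z≤n; s≤s)
open import Data.Nat.Combinatorics using (_C_; nCk+nC[k+1]≡[n+1]C[k+1]; nCk≡nC[n∸k]; nCn≡1; nC1≡n; k>n⇒nCk≡0)
open import Data.Nat.Properties
open import Data.Nat.Tactic.RingSolver using (solve-∀)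
open import Data.Bool as Bool using (Bool; true; false; _∧_; not; if_then_else_)
open import Data.Empty as Empty using (⊥-elim)
open import Data.Fin using (Fin; zero; suc)
open import Data.Fin.Subset using (Subset; ∣_∣; _∩_; ⊥)
open import Data.Fin.Subset.Properties using (anySubset?; ∩-idem; ∣⊥∣≡0)
open import Data.List as List using ([]; _∷_; map; drop; length; filterᵇ)
open import Data.List.Properties using (length-map; drop-map)
open import Data.List.Relation.Binary.Pointwise as PW using (Pointwise; []; _∷_)
open import Data.Product using (Σ; _×_; _,_; proj₁; proj₂)
open import Data.Sum using (_⊎_; inj₁; inj₂)
open import Data.Vec using (Vec; []; _∷_; head; tail; lookup; replicate; _++_)
open import Function using (_∘_)
open import Relation.Nullary using (Dec; yes; no; ¬_)
open import Relation.Nullary.Decidable using (_×-dec_; ¬?; decidable-stable)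
open import Relation.Binary.PropositionalEquality using (_≡_; _≢_; refl; sym; trans; cong; cong₂; subst; module ≡-Reasoning)

-- The certificate a ≤ b, u + b ≡ t + a + z for u ≤ t: linear inequalities reduce to semiring identities.
farkas : ∀ {a b u t} z → a ≤ b → t + a ≡ u + b + z → u ≤ t
farkas {a} {b} {u} {t} z a≤b eq = +-cancelʳ-≤ a u t (begin
  u + a     ≤⟨ +-monoʳ-≤ u a≤b ⟩
  u + b     ≤⟨ m≤m+n (u + b) z ⟩
  u + b + z ≡⟨ eq ⟨
  t + a     ∎)
  where open ≤-Reasoning

bit : Bool → ℕ
bit true  = 1
bit false = 0

∣∷∣ : ∀ {n} b (X : Subset n) → ∣ b ∷ X ∣ ≡ bit b + ∣ X ∣
∣∷∣ true  X = refl
∣∷∣ false X = refl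

prefix : ∀ {n} → Subset n → ℕ → ℕ
prefix []      t       = 0
prefix (b ∷ X) zero    = 0
prefix (b ∷ X) (suc t) = bit b + prefix X t

-- Matchings in shifted families

sumF : ∀ {s} → (Fin s → ℕ) → ℕ
sumF {zero}  f = 0
sumF {suc s} f = f zero + sumF (f ∘ suc)

sumF-cong : ∀ {s} {f g : Fin s → ℕ} → (∀ i → f i ≡ g i) → sumF f ≡ sumF g
sumF-cong {zero}  eq = refl
sumF-cong {suc s} eq = cong₂ _+_ (eq zero) (sumF-cong (eq ∘ suc))

sumF-+ : ∀ {s} (f g : Fin s → ℕ) → sumF (λ i → f i + g i) ≡ sumF f + sumF g
sumF-+ {zero}  f g = refl
sumF-+ {suc s} f g = trans (cong (f zero + g zero +_) (sumF-+ (f ∘ suc) (g ∘ suc)))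
  (interchange (f zero) (g zero) (sumF (f ∘ suc)) (sumF (g ∘ suc)))
  where
  interchange : ∀ a b c d → a + b + (c + d) ≡ a + c + (b + d)
  interchange = solve-∀

sumF≡0 : ∀ {s} (f : Fin s → ℕ) → sumF f ≡ 0 → ∀ i → f i ≡ 0
sumF≡0 f eq zero    = m+n≡0⇒m≡0 (f zero) eq
sumF≡0 f eq (suc i) = sumF≡0 (f ∘ suc) (m+n≡0⇒n≡0 (f zero) eq) i

-- A ⇝[ k ] B: read from the top, every element of A is matched to a smaller or equal element
-- of B, except that k elements of A are still waiting for a partner further down.
_⇝[_]_ : ∀ {n} → Subset n → ℕ → Subset n → Set
[]      ⇝[ k ] []      = k ≡ 0
(a ∷ A) ⇝[ k ] (b ∷ B) = Σ ℕ λ j → A ⇝[ j ] B × k + bit b ≡ j + bit a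

Below : ℕ → ℕ → Set
Below a b = b ≤ a

map-Below : ∀ k xs {ys} → Pointwise Below (drop k xs) ys → Pointwise Below (drop k (map suc xs)) (map suc ys)
map-Below k xs p = subst (λ zs → Pointwise Below zs _) (sym (drop-map k xs)) (PW.map⁺ suc suc (PW.map s≤s p))

length-elems : ∀ {n} (A : Subset n) → length (elems A) ≡ ∣ A ∣
length-elems []          = refl
length-elems (true ∷ A)  = cong suc (trans (length-map suc (elems A)) (length-elems A))
length-elems (false ∷ A) = trans (length-map suc (elems A)) (length-elems A)

⇝-size : ∀ {n k} (A B : Subset n) → A ⇝[ k ] B → k + ∣ B ∣ ≡ ∣ A ∣
⇝-size []      []      refl          = refl
⇝-size {k = k} (a ∷ A) (b ∷ B) (j , r , eq) = begin
  k + ∣ b ∷ B ∣       ≡⟨ cong (k +_) (∣∷∣ b B) ⟩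
  k + (bit b + ∣ B ∣) ≡⟨ +-assoc k (bit b) ∣ B ∣ ⟨
  k + bit b + ∣ B ∣   ≡⟨ cong (_+ ∣ B ∣) eq ⟩
  j + bit a + ∣ B ∣   ≡⟨ swap j (bit a) ∣ B ∣ ⟩
  bit a + (j + ∣ B ∣) ≡⟨ cong (bit a +_) (⇝-size A B r) ⟩
  bit a + ∣ A ∣       ≡⟨ ∣∷∣ a A ⟨
  ∣ a ∷ A ∣           ∎
  where
  open ≡-Reasoning
  swap : ∀ x y z → x + y + z ≡ y + (x + z)
  swap = solve-∀

drop-suc-Below : ∀ k xs ys → k < length xs → Pointwise Below (drop (suc k) (map suc xs)) ys →
  Pointwise Below (drop k (map suc xs)) (1 ∷ ys)
drop-suc-Below zero    (x ∷ xs) ys _         p = s≤s z≤n ∷ p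
drop-suc-Below (suc k) (x ∷ xs) ys (s≤s k<n) p = drop-suc-Below k xs ys k<n p

-- Service is first come, first served from the top, so the `k` elements left waiting are the `k`
-- smallest of `A`. They head the increasing list `elems A`, hence `drop k`.
⇝-elems : ∀ {n k} (A B : Subset n) → A ⇝[ k ] B → Pointwise Below (drop k (elems A)) (elems B)
-- The new lowest element of the target goes to the largest of the `suc k` waiting elements, which
-- is the entry of index `k` in the list.
partner : ∀ {n k} (A B : Subset n) → A ⇝[ suc k ] B →
  Pointwise Below (drop k (map suc (elems A))) (1 ∷ map suc (elems B))

⇝-elems [] [] refl = []
⇝-elems {k = k} (true ∷ A) (true ∷ B) (j , r , eq) with +-cancelʳ-≡ 1 k j eq
⇝-elems {k = zero}  (true ∷ A) (true ∷ B) (_ , r , eq) | refl = s≤s z≤n ∷ map-Below 0 (elems A) (⇝-elems A B r)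
⇝-elems {k = suc k} (true ∷ A) (true ∷ B) (_ , r , eq) | refl = partner A B r
⇝-elems {k = k} (true ∷ A) (false ∷ B) (j , r , eq) with trans (sym (+-identityʳ k)) (trans eq (+-comm j 1))
... | refl = map-Below j (elems A) (⇝-elems A B r)
⇝-elems {k = k} (false ∷ A) (true ∷ B) (j , r , eq) with trans (sym (+-identityʳ j)) (trans (sym eq) (+-comm k 1))
... | refl = partner A B r
⇝-elems {k = k} (false ∷ A) (false ∷ B) (j , r , eq) with +-cancelʳ-≡ 0 k j eq
... | refl = map-Below k (elems A) (⇝-elems A B r)

partner {k = k} A B r = drop-suc-Below k (elems A) _
  (subst (k <_) (trans (⇝-size A B r) (sym (length-elems A))) (m≤m+n (suc k) ∣ B ∣))
  (map-Below (suc k) (elems A) (⇝-elems A B r))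

-- One position is given to at most one set. `pred` covers both outcomes, since a position stays
-- idle exactly when nothing waits.
record Served {s} (q : Fin s → ℕ) : Set where
  field
    serve  : Fin s → Bool
    rest   : Fin s → ℕ
    split  : ∀ i → rest i + bit (serve i) ≡ q i
    single : ∀ i j → serve i ≡ true → serve j ≡ true → i ≡ j
    total  : sumF rest ≡ pred (sumF q)

cons : ∀ {s} {A : Set} → A → (Fin s → A) → Fin (suc s) → A
cons x f zero    = x
cons x f (suc i) = f i

serveOne : ∀ {s} (q : Fin s → ℕ) → Served q
serveOne {zero}  q = record { serve = λ () ; rest = λ () ; split = λ () ; single = λ () ; total = refl }
serveOne {suc s} q with q zero in eq
... | suc k = record
  { serve  = cons true (λ _ → false)
  ; rest   = cons k (q ∘ suc)
  ; split  = λ { zero → trans (+-comm k 1) (sym eq) ; (suc i) → +-identityʳ _ }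
  ; single = λ { zero zero _ _ → refl ; zero (suc j) _ () ; (suc i) j () _ }
  ; total  = cong (λ z → pred (z + sumF (q ∘ suc))) (sym eq)
  }
... | zero = record
  { serve  = cons false serve
  ; rest   = cons 0 rest
  ; split  = λ { zero → sym eq ; (suc i) → split i }
  ; single = λ { zero _ () _ ; (suc i) zero _ () ; (suc i) (suc j) p q → cong suc (single i j p q) }
  ; total  = trans total (cong (λ z → pred (z + sumF (q ∘ suc))) (sym eq))
  }
  where open Served (serveOne (q ∘ suc))

record Placed {n s} (B : Fin s → Subset n) : Set where
  field
    place    : Fin s → Subset n
    waiting  : Fin s → ℕ
    moved    : ∀ i → B i ⇝[ waiting i ] place i
    disjoint : ∀ i j → i ≢ j → place i ∩ place j ≡ ⊥
    time     : ℕ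
    time≤n   : time ≤ n
    overload : sumF waiting + time ≤ sumF (λ i → prefix (B i) time)

prefix-suc : ∀ {n} (X : Subset (suc n)) t → prefix X (suc t) ≡ bit (head X) + prefix (tail X) t
prefix-suc (b ∷ X) t = refl

prefix-zero : ∀ {n} (X : Subset n) → prefix X 0 ≡ 0
prefix-zero []      = refl
prefix-zero (b ∷ X) = refl

∷-⇝ : ∀ {n j k} b (X : Subset (suc n)) {Y} → tail X ⇝[ j ] Y → k + bit b ≡ j + bit (head X) → X ⇝[ k ] (b ∷ Y)
∷-⇝ b (x ∷ X) r eq = _ , r , eq

-- Elements are served greedily from the top. Positions that stay idle reset the queue, so the
-- elements still waiting at the end overload the initial segment ending at the last idle position.
placeAll : ∀ {n s} (B : Fin s → Subset n) → Placed B
placeAll {zero} {s} B = record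
  { place    = λ _ → []
  ; waiting  = λ _ → 0
  ; moved    = λ i → empty (B i)
  ; disjoint = λ _ _ _ → refl
  ; time     = 0
  ; time≤n   = z≤n
  ; overload = ≤-reflexive (trans (+-identityʳ _) (sumF-cong (λ i → sym (prefix-zero (B i)))))
  }
  where
  empty : (X : Subset 0) → X ⇝[ 0 ] []
  empty [] = refl
placeAll {suc n} {s} B = record
  { place    = λ i → serve i ∷ place i
  ; waiting  = rest
  ; moved    = λ i → ∷-⇝ (serve i) (B i) (moved i) (split i)
  ; disjoint = λ i j i≢j → cong₂ _∷_ (apart (serve i) (serve j) λ p q → i≢j (single i j p q)) (disjoint i j i≢j)
  ; time     = proj₁ result
  ; time≤n   = proj₁ (proj₂ result)
  ; overload = proj₂ (proj₂ result)
  }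
  where
  open Placed (placeAll (tail ∘ B))
  queue : Fin s → ℕ
  queue i = waiting i + bit (head (B i))
  open Served (serveOne queue)

  apart : ∀ a b → (a ≡ true → b ≡ true → Empty.⊥) → a ∧ b ≡ false
  apart true  true  no-both = ⊥-elim (no-both refl refl)
  apart true  false no-both = refl
  apart false b     no-both = refl

  heads : ℕ
  heads = sumF (λ i → bit (head (B i)))
  later : ℕ
  later = sumF (λ i → prefix (tail (B i)) time)

  later-prefix : heads + later ≡ sumF (λ i → prefix (B i) (suc time))
  later-prefix = sym (trans (sumF-cong (λ i → prefix-suc (B i) time)) (sumF-+ (λ i → bit (head (B i))) (λ i → prefix (tail (B i)) time)))

  result : Σ ℕ λ t → t ≤ suc n × sumF rest + t ≤ sumF (λ i → prefix (B i) t)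
  result with sumF queue in eq
  ... | zero  = 0 , z≤n , ≤-trans (≤-reflexive (trans (+-identityʳ _) (trans total (cong pred eq)))) z≤n
  ... | suc x = suc time , s≤s time≤n , (begin
    sumF rest + suc time             ≡⟨ cong (_+ suc time) (trans total (cong pred eq)) ⟩
    x + suc time                     ≡⟨ +-suc x time ⟩
    suc x + time                     ≡⟨ cong (_+ time) eq ⟨
    sumF queue + time                ≡⟨ cong (_+ time) (sumF-+ waiting (λ i → bit (head (B i)))) ⟩
    sumF waiting + heads + time      ≡⟨ swap (sumF waiting) heads time ⟩
    heads + (sumF waiting + time)    ≤⟨ +-monoʳ-≤ heads overload ⟩
    heads + later                    ≡⟨ later-prefix ⟩
    sumF (λ i → prefix (B i) (suc time)) ∎)
    where
    open ≤-Reasoning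
    swap : ∀ a b c → a + b + c ≡ b + (a + c)
    swap = solve-∀

-- Hall's condition on initial segments suffices because a shifted family may replace each of
-- its members by the set it is served.
shifted-matching : ∀ {n s} (F : Family n) → Shifted F → (B : Fin s → Subset n) → (∀ i → B i ∈F F) →
  (∀ i j → i ≢ j → 0 < ∣ B i ∣ + ∣ B j ∣) →
  (∀ t → t ≤ n → sumF (λ i → prefix (B i) t) ≤ t) → HasMatching F s
shifted-matching {n} F shifted B B∈F nonempty light = place , in-F , λ i j i≢j → disjoint i j i≢j , distinct i j i≢j
  where
  open Placed (placeAll B)

  no-wait : ∀ i → waiting i ≡ 0
  no-wait = sumF≡0 waiting (n≤0⇒n≡0 (+-cancelʳ-≤ time _ 0 (≤-trans overload (light time time≤n))))

  moved₀ : ∀ i → B i ⇝[ 0 ] place i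
  moved₀ i = subst (λ k → B i ⇝[ k ] place i) (no-wait i) (moved i)

  in-F : ∀ i → place i ∈F F
  in-F i = shifted (B i) (place i) (B∈F i) (⇝-elems (B i) (place i) (moved₀ i))

  size : ∀ i → ∣ place i ∣ ≡ ∣ B i ∣
  size i = ⇝-size (B i) (place i) (moved₀ i)

  -- Disjointness does not exclude two empty members. Equal disjoint sets are empty, and `nonempty`
  -- allows at most one empty `B i`.
  distinct : ∀ i j → i ≢ j → place i ≢ place j
  distinct i j i≢j eq = <⇒≢ (nonempty i j i≢j) (sym (trans (cong₂ _+_ (empty i place-i≡⊥) (empty j (trans (sym eq) place-i≡⊥))) refl))
    where
    place-i≡⊥ : place i ≡ ⊥
    place-i≡⊥ = trans (sym (∩-idem (place i))) (trans (cong (place i ∩_) eq) (disjoint i j i≢j))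
    empty : ∀ k → place k ≡ ⊥ → ∣ B k ∣ ≡ 0
    empty k eq = trans (sym (size k)) (trans (cong ∣_∣ eq) (∣⊥∣≡0 n))

-- Sets with few elements near the top

prefix≤size : ∀ {n} (X : Subset n) t → prefix X t ≤ ∣ X ∣
prefix≤size []      t       = z≤n
prefix≤size (b ∷ X) zero    = z≤n
prefix≤size (b ∷ X) (suc t) = ≤-trans (+-monoʳ-≤ (bit b) (prefix≤size X t)) (≤-reflexive (sym (∣∷∣ b X)))

prefix-full : ∀ {n} (X : Subset n) → prefix X n ≡ ∣ X ∣
prefix-full []      = refl
prefix-full (b ∷ X) = trans (cong (bit b +_) (prefix-full X)) (sym (∣∷∣ b X))

bit≤1 : ∀ b → bit b ≤ 1
bit≤1 true  = ≤-refl
bit≤1 false = z≤n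

prefix-+ : ∀ {n} (X : Subset n) t e → prefix X (t + e) ≤ prefix X t + e
prefix-+ []      t       e       = z≤n
prefix-+ (b ∷ X) zero    zero    = z≤n
prefix-+ (b ∷ X) zero    (suc e) = +-mono-≤ (bit≤1 b) (subst (λ z → prefix X e ≤ z + e) (prefix-zero X) (prefix-+ X 0 e))
prefix-+ (b ∷ X) (suc t) e       = ≤-trans (+-monoʳ-≤ (bit b) (prefix-+ X t e)) (≤-reflexive (sym (+-assoc (bit b) _ e)))

prefix≤t : ∀ {n} (X : Subset n) t → prefix X t ≤ t
prefix≤t X t = subst (λ z → prefix X t ≤ z + t) (prefix-zero X) (prefix-+ X 0 t)

∣∩seg∣ : ∀ {n} (X : Subset n) t → ∣ X ∩ seg n t ∣ ≡ prefix X t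
∣∩seg∣ []          t       = refl
∣∩seg∣ (true ∷ X)  zero    = trans (∣∩seg∣ X 0) (prefix-zero X)
∣∩seg∣ (false ∷ X) zero    = trans (∣∩seg∣ X 0) (prefix-zero X)
∣∩seg∣ (true ∷ X)  (suc t) = cong suc (∣∩seg∣ X t)
∣∩seg∣ (false ∷ X) (suc t) = ∣∩seg∣ X t

pad : ∀ {n} lo → Subset n → Subset (lo + n)
pad lo X = replicate lo false ++ X

prefix-pad : ∀ {n} lo (X : Subset n) t → prefix (pad lo X) t ≡ prefix X (t ∸ lo)
prefix-pad zero     X t       = refl
prefix-pad (suc lo) X zero    = sym (prefix-zero X)
prefix-pad (suc lo) X (suc t) = prefix-pad lo X t

∣pad∣ : ∀ {n} lo (X : Subset n) → ∣ pad lo X ∣ ≡ ∣ X ∣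
∣pad∣ zero     X = refl
∣pad∣ (suc lo) X = ∣pad∣ lo X

prefix-++ : ∀ {r J} (A : Subset r) (D : Subset J) t → prefix (A ++ D) t ≤ ∣ A ∣ + prefix D (t ∸ r)
prefix-++ []      D t       = ≤-refl
prefix-++ (a ∷ A) D zero    = z≤n
prefix-++ (a ∷ A) D (suc t) = ≤-trans (+-monoʳ-≤ (bit a) (prefix-++ A D t))
  (≤-reflexive (trans (sym (+-assoc (bit a) ∣ A ∣ _)) (cong (_+ prefix D _) (sym (∣∷∣ a A)))))

∣++∣ : ∀ {r J} (A : Subset r) (D : Subset J) → ∣ A ++ D ∣ ≡ ∣ A ∣ + ∣ D ∣
∣++∣ []      D = refl
∣++∣ (true ∷ A)  D = cong suc (∣++∣ A D)
∣++∣ (false ∷ A) D = ∣++∣ A D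

≡ᵇ-refl : ∀ n → (n ≡ᵇ n) ≡ true
≡ᵇ-refl zero    = refl
≡ᵇ-refl (suc n) = ≡ᵇ-refl n

≡ᵇ-sound : ∀ m n → (m ≡ᵇ n) ≡ true → m ≡ n
≡ᵇ-sound zero    zero    eq = refl
≡ᵇ-sound (suc m) (suc n) eq = cong suc (≡ᵇ-sound m n eq)

<⇒≡ᵇ-false : ∀ m n → m < n → (n ≡ᵇ m) ≡ false
<⇒≡ᵇ-false zero    (suc n) _         = refl
<⇒≡ᵇ-false (suc m) (suc n) (s≤s m<n) = <⇒≡ᵇ-false m n m<n

-- Ranks count elements from the top: rank q is the element with exactly q larger ones.
top₁ : ∀ J → ℕ → Subset J
top₁ zero    q = []
top₁ (suc J) q = (J ≡ᵇ q) ∷ top₁ J q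

-- Meant for `a < b`: the element of rank `b` is the lower one and is met first, after which `top₁`
-- places rank `a`.
top₂ : ∀ J → ℕ → ℕ → Subset J
top₂ zero    a b = []
top₂ (suc J) a b = if J ≡ᵇ b then true ∷ top₁ J a else false ∷ top₂ J a b

top₁-above : ∀ J q t → J ≤ q → prefix (top₁ J q) t ≡ 0
top₁-above zero    q t       J≤q = refl
top₁-above (suc J) q zero    J≤q = refl
top₁-above (suc J) q (suc t) J<q with J ≡ᵇ q in eq
... | true  = ⊥-elim (<⇒≢ J<q (≡ᵇ-sound J q eq))
... | false = top₁-above J q t (<⇒≤ J<q)

prefix-top₁≤1 : ∀ J q t → prefix (top₁ J q) t ≤ 1
prefix-top₁≤1 zero    q t       = z≤n
prefix-top₁≤1 (suc J) q zero    = z≤n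
prefix-top₁≤1 (suc J) q (suc t) with J ≡ᵇ q in eq
... | true  = ≤-reflexive (cong suc (top₁-above J q t (≤-reflexive (≡ᵇ-sound J q eq))))
... | false = prefix-top₁≤1 J q t

-- The `d` elements cut off at the top are those of rank below `d`.
prefix-top₁≡0 : ∀ {J q} t d → t + d ≡ J → q < d → prefix (top₁ J q) t ≡ 0
prefix-top₁≡0 {J} {q} zero    d refl q<d = prefix-zero (top₁ J q)
prefix-top₁≡0 {q = q} (suc t) d refl q<d rewrite <⇒≡ᵇ-false q (t + d) (≤-trans q<d (m≤n+m d t)) = prefix-top₁≡0 t d refl q<d

prefix-top₂≤2 : ∀ J a b t → prefix (top₂ J a b) t ≤ 2
prefix-top₂≤2 zero    a b t       = z≤n
prefix-top₂≤2 (suc J) a b t with J ≡ᵇ b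
prefix-top₂≤2 (suc J) a b zero    | true  = z≤n
prefix-top₂≤2 (suc J) a b (suc t) | true  = s≤s (prefix-top₁≤1 J a t)
prefix-top₂≤2 (suc J) a b zero    | false = z≤n
prefix-top₂≤2 (suc J) a b (suc t) | false = prefix-top₂≤2 J a b t

prefix-top₂≤1 : ∀ {J a b} t d → t + d ≡ J → a < d → prefix (top₂ J a b) t ≤ 1
prefix-top₂≤1 {J} {a} {b} zero    d refl a<d = ≤-trans (≤-reflexive (prefix-zero (top₂ J a b))) z≤n
prefix-top₂≤1 {b = b} (suc t) d refl a<d with t + d ≡ᵇ b
... | true  = ≤-reflexive (cong suc (prefix-top₁≡0 t d refl a<d))
... | false = prefix-top₂≤1 t d refl a<d

prefix-top₂≡0 : ∀ {J a b} t d → t + d ≡ J → b < d → prefix (top₂ J a b) t ≡ 0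
prefix-top₂≡0 {J} {a} {b} zero    d refl b<d = prefix-zero (top₂ J a b)
prefix-top₂≡0 {b = b} (suc t) d refl b<d rewrite <⇒≡ᵇ-false b (t + d) (≤-trans b<d (m≤n+m d t)) = prefix-top₂≡0 t d refl b<d

∣top₁∣ : ∀ J q → q < J → ∣ top₁ J q ∣ ≡ 1
∣top₁∣ (suc J) q (s≤s q≤J) with J ≡ᵇ q in eq
... | true  = cong suc (trans (sym (prefix-full (top₁ J q))) (top₁-above J q J (≤-reflexive (≡ᵇ-sound J q eq))))
... | false = ∣top₁∣ J q (≤∧≢⇒< q≤J λ { refl → case-absurd (trans (sym eq) (≡ᵇ-refl q)) })
  where
  case-absurd : false ≡ true → Empty.⊥
  case-absurd ()

-- The equation for `n` is an argument because the same `[n]` is later cut in two ways, at `L` and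
-- at `k * s + L`.
block : ∀ {n} lo {r J} → n ≡ lo + (r + J) → Subset r → Subset J → Subset n
block lo refl A D = pad lo (A ++ D)

block-low : ∀ {n} lo {r J} (eq : n ≡ lo + (r + J)) (A : Subset r) (D : Subset J) t → t ≤ lo → prefix (block lo eq A D) t ≡ 0
block-low lo refl A D t t≤lo = trans (prefix-pad lo (A ++ D) t)
  (trans (cong (prefix (A ++ D)) (m≤n⇒m∸n≡0 t≤lo)) (prefix-zero (A ++ D)))

prefix-block : ∀ {n} lo {r J} (eq : n ≡ lo + (r + J)) (A : Subset r) (D : Subset J) t →
  prefix (block lo eq A D) t ≤ ∣ A ∣ + prefix D (t ∸ lo ∸ r)
prefix-block lo refl A D t = ≤-trans (≤-reflexive (prefix-pad lo (A ++ D) t)) (prefix-++ A D (t ∸ lo))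

∣block∣ : ∀ {n} lo {r J} (eq : n ≡ lo + (r + J)) (A : Subset r) (D : Subset J) → ∣ block lo eq A D ∣ ≡ ∣ A ∣ + ∣ D ∣
∣block∣ lo refl A D = trans (∣pad∣ lo (A ++ D)) (∣++∣ A D)

block-mid : ∀ {n} lo {r J} (eq : n ≡ lo + (r + J)) (A : Subset r) (D : Subset J) t → t + J ≤ n → prefix (block lo eq A D) t ≤ ∣ A ∣
block-mid lo {r} {J} refl A D t t+J≤n = begin
  prefix (pad lo (A ++ D)) t     ≤⟨ prefix-block lo refl A D t ⟩
  ∣ A ∣ + prefix D (t ∸ lo ∸ r)  ≡⟨ cong (λ z → ∣ A ∣ + prefix D z) (trans (∸-+-assoc t lo r) (m≤n⇒m∸n≡0 t≤lo+r)) ⟩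
  ∣ A ∣ + prefix D 0             ≡⟨ cong (∣ A ∣ +_) (prefix-zero D) ⟩
  ∣ A ∣ + 0                      ≡⟨ +-identityʳ ∣ A ∣ ⟩
  ∣ A ∣                          ∎
  where
  open ≤-Reasoning
  t≤lo+r : t ≤ lo + r
  t≤lo+r = +-cancelʳ-≤ J t (lo + r) (≤-trans t+J≤n (≤-reflexive (sym (+-assoc lo r J))))

block-high : ∀ {n} lo {r J} (eq : n ≡ lo + (r + J)) (A : Subset r) (D : Subset J) {bound} t d → t + d ≡ n → d ≤ J →
  (∀ e → e + d ≡ J → prefix D e ≤ bound) → prefix (block lo eq A D) t ≤ ∣ A ∣ + bound
block-high lo {r} {J} eq A D t d t+d≡n d≤J D≤ = ≤-trans (prefix-block lo eq A D t) (+-monoʳ-≤ ∣ A ∣ (D≤ (t ∸ lo ∸ r) (begin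
  t ∸ lo ∸ r + d                ≡⟨ cong (λ z → z ∸ lo ∸ r + d) t≡ ⟩
  lo + (r + (J ∸ d)) ∸ lo ∸ r + d ≡⟨ cong (λ z → z ∸ r + d) (m+n∸m≡n lo _) ⟩
  r + (J ∸ d) ∸ r + d           ≡⟨ cong (_+ d) (m+n∸m≡n r _) ⟩
  J ∸ d + d                     ≡⟨ m∸n+n≡m d≤J ⟩
  J                             ∎)))
  where
  open ≡-Reasoning
  assoc³ : ∀ a b c d → a + (b + c) + d ≡ a + (b + (c + d))
  assoc³ = solve-∀
  t≡ : t ≡ lo + (r + (J ∸ d))
  t≡ = +-cancelʳ-≡ d t _ (trans t+d≡n (trans eq (sym (trans (assoc³ lo r (J ∸ d) d) (cong (λ z → lo + (r + z)) (m∸n+n≡m d≤J))))))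

-- What the matching uses of a set consisting of k elements in (L, n - J] and one or two elements
-- of the given ranks above n - J.
record Single {n} (k L J q : ℕ) (X : Subset n) : Set where
  field
    size  : 0 < ∣ X ∣
    low   : ∀ t → t ≤ L → prefix X t ≡ 0
    mid   : ∀ t → t + J ≤ n → prefix X t ≤ k
    all   : ∀ t → prefix X t ≤ k + 1
    above : ∀ t d → t + d ≡ n → d ≤ J → q < d → prefix X t ≤ k + 0

record Double {n} (k L J a b : ℕ) (X : Subset n) : Set where
  field
    size   : 0 < ∣ X ∣
    low    : ∀ t → t ≤ L → prefix X t ≡ 0
    mid    : ∀ t → t + J ≤ n → prefix X t ≤ k
    all    : ∀ t → prefix X t ≤ k + 2
    above₁ : ∀ t d → t + d ≡ n → d ≤ J → a < d → prefix X t ≤ k + 1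
    above₂ : ∀ t d → t + d ≡ n → d ≤ J → b < d → prefix X t ≤ k + 0

block-single : ∀ {n} lo {r J k} (eq : n ≡ lo + (r + J)) (A : Subset r) q →
  ∣ A ∣ ≡ k → 0 < k → Single k lo J q (block lo eq A (top₁ J q))
block-single lo {r} {J} eq A q refl 0<k = record
  { size  = ≤-trans 0<k (≤-trans (m≤m+n _ _) (≤-reflexive (sym (∣block∣ lo eq A (top₁ J q)))))
  ; low   = block-low lo eq A (top₁ J q)
  ; mid   = block-mid lo eq A (top₁ J q)
  ; all   = λ t → ≤-trans (prefix-block lo eq A (top₁ J q) t) (+-monoʳ-≤ ∣ A ∣ (prefix-top₁≤1 J q _))
  ; above = λ t d e d≤J q<d → block-high lo eq A (top₁ J q) t d e d≤J (λ e eq → ≤-reflexive (prefix-top₁≡0 e d eq q<d))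
  }

block-double : ∀ {n} lo {r J k} (eq : n ≡ lo + (r + J)) (A : Subset r) a b →
  ∣ A ∣ ≡ k → 0 < k → Double k lo J a b (block lo eq A (top₂ J a b))
block-double lo {r} {J} eq A a b refl 0<k = record
  { size   = ≤-trans 0<k (≤-trans (m≤m+n _ _) (≤-reflexive (sym (∣block∣ lo eq A (top₂ J a b)))))
  ; low    = block-low lo eq A (top₂ J a b)
  ; mid    = block-mid lo eq A (top₂ J a b)
  ; all    = λ t → ≤-trans (prefix-block lo eq A (top₂ J a b) t) (+-monoʳ-≤ ∣ A ∣ (prefix-top₂≤2 J a b _))
  ; above₁ = λ t d e d≤J a<d → block-high lo eq A (top₂ J a b) t d e d≤J (λ e eq → prefix-top₂≤1 e d eq a<d)
  ; above₂ = λ t d e d≤J b<d → block-high lo eq A (top₂ J a b) t d e d≤J (λ e eq → ≤-reflexive (prefix-top₂≡0 e d eq b<d))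
  }

-- Matchings assembled from repeated members

all-++ : ∀ {A : Set} {l} (Q : A → Set) u {x} (V : Vec A l) → Q x → (∀ i → Q (lookup V i)) → ∀ i → Q (lookup (replicate u x ++ V) i)
all-++ Q zero    V Qx QV i       = QV i
all-++ Q (suc u) V Qx QV zero    = Qx
all-++ Q (suc u) V Qx QV (suc i) = all-++ Q u V Qx QV i

sumF-++ : ∀ {A : Set} {l} (g : A → ℕ) u x (V : Vec A l) →
  sumF (λ i → g (lookup (replicate u x ++ V) i)) ≡ u * g x + sumF (λ i → g (lookup V i))
sumF-++ g zero    x V = refl
sumF-++ g (suc u) x V = trans (cong (g x +_) (sumF-++ g u x V)) (sym (+-assoc (g x) (u * g x) _))

-- Copies of one member may be used, since `shifted-matching` moves them apart; only their
-- multiplicities enter its condition.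
mix : ∀ {n} u v w → Subset n → Subset n → Subset n → Vec (Subset n) (u + (v + (w + 0)))
mix u v w X Y Z = replicate u X ++ (replicate v Y ++ (replicate w Z ++ []))

mix-all : ∀ {n} (Q : Subset n → Set) u v w {X Y Z} → Q X → Q Y → Q Z → ∀ i → Q (lookup (mix u v w X Y Z) i)
mix-all Q u v w X Y Z = all-++ Q u _ X (all-++ Q v _ Y (all-++ Q w [] Z λ ()))

mix-sum : ∀ {n} (g : Subset n → ℕ) u v w X Y Z →
  sumF (λ i → g (lookup (mix u v w X Y Z) i)) ≡ u * g X + (v * g Y + w * g Z)
mix-sum g u v w X Y Z = trans (sumF-++ g u X _) (cong (u * g X +_)
  (trans (sumF-++ g v Y _) (cong (v * g Y +_) (trans (sumF-++ g w Z []) (+-identityʳ _)))))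

-- σ tells whether the matching uses the exceptional member P.
data Extra {n} (F : Family n) : ℕ → (ℕ → ℕ) → Set where
  none : Extra F 0 (λ _ → 0)
  one  : ∀ P → P ∈F F → Extra F 1 (prefix P)

no-light-mix : ∀ {n s σ p} (F : Family n) → Shifted F → νLess F s → ∀ u v w {X Y Z} →
  X ∈F F → Y ∈F F → Z ∈F F → 0 < ∣ X ∣ → 0 < ∣ Y ∣ → 0 < ∣ Z ∣ →
  Extra F σ p → s ≡ σ + (u + (v + w)) →
  (∀ t → t ≤ n → p t + (u * prefix X t + (v * prefix Y t + w * prefix Z t)) ≤ t) → Empty.⊥
no-light-mix F shifted ν u v w {X} {Y} {Z} X∈ Y∈ Z∈ X+ Y+ Z+ none refl light =
  ν (subst (HasMatching F) (cong (λ z → u + (v + z)) (+-identityʳ w))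
    (shifted-matching F shifted (lookup (mix u v w X Y Z)) (mix-all (_∈F F) u v w X∈ Y∈ Z∈)
      (λ i j _ → ≤-trans (mix-all (λ X → 0 < ∣ X ∣) u v w X+ Y+ Z+ i) (m≤m+n _ _))
      (λ t t≤n → ≤-trans (≤-reflexive (mix-sum (λ X → prefix X t) u v w X Y Z)) (light t t≤n))))
no-light-mix F shifted ν u v w {X} {Y} {Z} X∈ Y∈ Z∈ X+ Y+ Z+ (one P P∈) refl light =
  ν (subst (λ z → HasMatching F (suc z)) (cong (λ z → u + (v + z)) (+-identityʳ w))
    (shifted-matching F shifted (lookup (P ∷ mix u v w X Y Z))
      (λ { zero → P∈ ; (suc i) → mix-all (_∈F F) u v w X∈ Y∈ Z∈ i })
      (λ { zero zero 0≢0 → ⊥-elim (0≢0 refl)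
         -- `P` may be empty, so positivity comes from the other set.
         ; zero (suc j) _ → ≤-trans (positive j) (m≤n+m _ _)
         ; (suc i) j _ → ≤-trans (positive i) (m≤m+n _ _) })
      (λ t t≤n → ≤-trans (≤-reflexive (cong (prefix P t +_) (mix-sum (λ X → prefix X t) u v w X Y Z))) (light t t≤n))))
  where
  positive : ∀ i → 0 < ∣ lookup (mix u v w X Y Z) i ∣
  positive = mix-all (λ X → 0 < ∣ X ∣) u v w X+ Y+ Z+

-- The counting condition has to be verified only for the initial segments [n - d] with d ≤ J:
-- on shorter ones, at most m + c + (u + J) k ≤ L elements occur before k s + L, and at most
-- k s more come from the sets Z.
light-below : ∀ {n k s J L w} M u (p x y z : ℕ → ℕ) →
  (∀ t → p t ≤ t) → (∀ t → p t ≤ M) → u ≤ M → w ≤ s → M + (M + J) * k ≤ L →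
  (∀ t → t ≤ L → x t ≡ 0) → (∀ t → t ≤ L → y t ≡ 0) → (∀ t → t ≤ k * s + L → z t ≡ 0) →
  (∀ t → t + J ≤ n → x t ≤ k) → (∀ t → t + J ≤ n → y t ≤ k) → (∀ t → t + J ≤ n → z t ≤ k) →
  (∀ t d → t + d ≡ n → d ≤ J → p t + (u * x t + (J * y t + w * z t)) ≤ t) →
  ∀ t → t ≤ n → p t + (u * x t + (J * y t + w * z t)) ≤ t
light-below {n} {k} {s} {J} {L} {w} M u p x y z p≤t p≤M u≤M w≤s L-large x-low y-low z-low x-mid y-mid z-mid top t t≤n
  with ≤-total (t + J) n
... | inj₂ n≤t+J = top t (n ∸ t) (m+[n∸m]≡n t≤n) (m≤n+o⇒m∸n≤o n t n≤t+J)
... | inj₁ t+J≤n with ≤-total t L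
... | inj₁ t≤L rewrite x-low t t≤L | y-low t t≤L | z-low t (≤-trans t≤L (m≤n+m L (k * s))) | *-zeroʳ u | *-zeroʳ J | *-zeroʳ w =
  ≤-trans (≤-reflexive (+-identityʳ (p t))) (p≤t t)
... | inj₂ L≤t with ≤-total t (k * s + L)
... | inj₁ t≤ks+L rewrite z-low t t≤ks+L | *-zeroʳ w = begin
  p t + (u * x t + (J * y t + 0))
    ≤⟨ +-mono-≤ (p≤M t) (+-mono-≤ (*-mono-≤ u≤M (x-mid t t+J≤n)) (+-monoˡ-≤ 0 (*-monoʳ-≤ J (y-mid t t+J≤n)))) ⟩
  M + (M * k + (J * k + 0))       ≡⟨ regroup M J k ⟩
  M + (M + J) * k                 ≤⟨ L-large ⟩
  L                               ≤⟨ L≤t ⟩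
  t                               ∎
  where
  open ≤-Reasoning
  regroup : ∀ M J k → M + (M * k + (J * k + 0)) ≡ M + (M + J) * k
  regroup = solve-∀
... | inj₂ ks+L≤t = begin
  p t + (u * x t + (J * y t + w * z t))
    ≤⟨ +-mono-≤ (p≤M t) (+-mono-≤ (*-mono-≤ u≤M (x-mid t t+J≤n)) (+-mono-≤ (*-monoʳ-≤ J (y-mid t t+J≤n)) (*-mono-≤ w≤s (z-mid t t+J≤n)))) ⟩
  M + (M * k + (J * k + s * k))         ≡⟨ regroup M J k s ⟩
  k * s + (M + (M + J) * k)             ≤⟨ +-monoʳ-≤ (k * s) L-large ⟩
  k * s + L                             ≤⟨ ks+L≤t ⟩
  t                                     ∎
  where
  open ≤-Reasoning
  regroup : ∀ M J k s → M + (M * k + (J * k + s * k)) ≡ k * s + (M + (M + J) * k)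
  regroup = solve-∀

-- The segment `[n - d]` offers `k + 1` places per set of the matching, plus `c - d`. Copies of `Z`
-- stay within this quota; `α` and `β` bound what `X` and `Y` use beyond `k`. Hence neither `w` nor
-- `s` occurs in the remaining budget.
top-weight : ∀ {n s c} k σ u J w {p x y z t d} α β → n ≡ suc k * s + c → s ≡ σ + (u + (J + w)) → t + d ≡ n →
  x ≤ k + α → y ≤ k + β → z ≤ k + 1 →
  p + u * α + J * β + d ≤ suc k * σ + u + J + c →
  p + (u * x + (J * y + w * z)) ≤ t
top-weight {c = c} k σ u J w {p} {x} {y} {z} {t} {d} α β refl refl t+d≡n x≤ y≤ z≤ weight = +-cancelʳ-≤ d _ t (begin
  p + (u * x + (J * y + w * z)) + d
    ≤⟨ +-monoˡ-≤ d (+-monoʳ-≤ p (+-mono-≤ (*-monoʳ-≤ u x≤) (+-mono-≤ (*-monoʳ-≤ J y≤) (*-monoʳ-≤ w z≤)))) ⟩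
  p + (u * (k + α) + (J * (k + β) + w * (k + 1))) + d             ≡⟨ regroup p u k α J β w d ⟩
  p + u * α + J * β + d + (k * (u + (J + w)) + w)                 ≤⟨ +-monoˡ-≤ _ weight ⟩
  suc k * σ + u + J + c + (k * (u + (J + w)) + w)                 ≡⟨ regroup′ k σ u J w c ⟩
  suc k * (σ + (u + (J + w))) + c                                 ≡⟨ t+d≡n ⟨
  t + d                                                           ∎)
  where
  open ≤-Reasoning
  regroup : ∀ p u k α J β w d → p + (u * (k + α) + (J * (k + β) + w * (k + 1))) + d ≡ p + u * α + J * β + d + (k * (u + (J + w)) + w)
  regroup = solve-∀
  regroup′ : ∀ k σ u J w c → suc k * σ + u + J + c + (k * (u + (J + w)) + w) ≡ suc k * (σ + (u + (J + w))) + c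
  regroup′ = solve-∀

-- The critical configurations

module Configuration {n k c s J L q₀ : ℕ} (F : Family n) (shifted : Shifted F) (ν : νLess F s)
  (n≡ : n ≡ suc k * s + c) (L-large : suc k + c + (suc k + c + J) * k ≤ L) (s-large : suc (suc k + c + J) ≤ s)
  {Z : Subset n} (Z∈ : Z ∈F F) (single-Z : Single k (k * s + L) J q₀ Z) where

  M : ℕ
  M = suc k + c

  Top : ℕ → (ℕ → ℕ) → ℕ → Subset n → Subset n → Set
  Top σ p u X Y = ∀ t d → t + d ≡ n → d ≤ J → Σ ℕ λ α → Σ ℕ λ β →
    prefix X t ≤ k + α × prefix Y t ≤ k + β × p t + u * α + J * β + d ≤ suc k * σ + u + J + c

  -- The reason for `J` copies of `Y`: once `d` exceeds the rank of its top element, each copy is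
  -- one below its quota, and this gain of `J` pays for any cut `d ≤ J`.
  no-mix : ∀ u {σ p X Y q} → Extra F σ p → (∀ t → p t ≤ M) → u ≤ M → X ∈F F → Y ∈F F →
    0 < ∣ X ∣ → (∀ t → t ≤ L → prefix X t ≡ 0) → (∀ t → t + J ≤ n → prefix X t ≤ k) → Single k L J q Y →
    Top σ p u X Y → Empty.⊥
  no-mix u {σ} {p} {X} {Y} extra p≤M u≤M X∈ Y∈ X+ X-low X-mid single-Y top =
    no-light-mix F shifted ν u J w X∈ Y∈ Z∈ X+ (Single.size single-Y) (Single.size single-Z) extra s≡
      (light-below M u p (prefix X) (prefix Y) (prefix Z) (p≤t extra) p≤M u≤M w≤s L-large
        X-low (Single.low single-Y) (Single.low single-Z) X-mid (Single.mid single-Y) (Single.mid single-Z) top′)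
    where
    σ≤1 : Extra F σ p → σ ≤ 1
    σ≤1 none      = z≤n
    σ≤1 (one _ _) = ≤-refl
    p≤t : Extra F σ p → ∀ t → p t ≤ t
    p≤t none      t = z≤n
    p≤t (one P _) t = prefix≤t P t
    w : ℕ
    w = s ∸ (σ + (u + J))
    fits : σ + (u + J) ≤ s
    fits = ≤-trans (+-mono-≤ (σ≤1 extra) (+-monoˡ-≤ J u≤M)) s-large
    w≤s : w ≤ s
    w≤s = m∸n≤m s (σ + (u + J))
    s≡ : s ≡ σ + (u + (J + w))
    s≡ = trans (sym (m+[n∸m]≡n fits)) (regroup σ u J w)
      where
      regroup : ∀ σ u J w → σ + (u + J) + w ≡ σ + (u + (J + w))
      regroup = solve-∀
    top′ : ∀ t d → t + d ≡ n → d ≤ J → p t + (u * prefix X t + (J * prefix Y t + w * prefix Z t)) ≤ t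
    top′ t d t+d≡n d≤J with top t d t+d≡n d≤J
    ... | α , β , x≤ , y≤ , weight = top-weight k σ u J w α β n≡ s≡ t+d≡n x≤ y≤ (Single.all single-Z t) weight

  -- For `d ≤ j` the surplus `c` of `n` over `suc k * s` pays for the cut, for `d > j` the copies of
  -- `Y` do. The place of `X` is filled with multiplicity 0.
  low-single : ∀ {Y j} → j ≤ c → Y ∈F F → Single k L J j Y → Empty.⊥
  low-single {Y} {j} j≤c Y∈ single-Y = no-mix 0 none (λ _ → z≤n) z≤n Y∈ Y∈ size low mid single-Y top
    where
    open Single single-Y
    top : Top 0 (λ _ → 0) 0 Y Y
    top t d t+d≡n d≤J with d ≤? j
    ... | yes d≤j = 1 , 1 , all t , all t , farkas 0 (≤-trans d≤j j≤c) (identity k J c d)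
      where
      identity : ∀ k J c d → suc k * 0 + 0 + J + c + d ≡ 0 + 0 * 1 + J * 1 + d + c + 0
      identity = solve-∀
    ... | no d≰j = 1 , 0 , all t , above t d t+d≡n d≤J (≰⇒> d≰j) , farkas c d≤J (identity k J c d)
      where
      identity : ∀ k J c d → suc k * 0 + 0 + J + c + d ≡ 0 + 0 * 1 + J * 0 + d + J + c
      identity = solve-∀

  -- The surplus `c` falls short for `c < d ≤ j`. There both top elements of `X` are cut off, and
  -- its `u = j - c` copies gain what is missing. They exceed their quota only for `d ≤ a`, at a
  -- cost of `u`, for which `a + u ≤ c` leaves room.
  low-double : ∀ {X Y a b j} u → u + c ≡ j → a + j ≤ c + c → b ≤ c → X ∈F F → Y ∈F F →
    Double k L J a b X → Single k L J j Y → Empty.⊥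
  low-double {X} {Y} {a} {b} {j} u refl a+j≤2c b≤c X∈ Y∈ double-X single-Y =
    no-mix u none (λ _ → z≤n) (≤-trans u≤c (m≤n+m c (suc k))) X∈ Y∈
      (Double.size double-X) (Double.low double-X) (Double.mid double-X) single-Y top
    where
    module X = Double double-X
    module Y = Single single-Y
    a+u≤c : a + u ≤ c
    a+u≤c = +-cancelʳ-≤ c (a + u) c (≤-trans (≤-reflexive (+-assoc a u c)) a+j≤2c)
    u≤c : u ≤ c
    u≤c = ≤-trans (m≤n+m u a) a+u≤c
    top : Top 0 (λ _ → 0) u X Y
    top t d t+d≡n d≤J with d ≤? a
    ... | yes d≤a = 2 , 1 , X.all t , Y.all t , farkas 0 (≤-trans (+-monoˡ-≤ u d≤a) a+u≤c) (identity k u J c d)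
      where
      identity : ∀ k u J c d → suc k * 0 + u + J + c + (d + u) ≡ 0 + u * 2 + J * 1 + d + c + 0
      identity = solve-∀
    ... | no d≰a with d ≤? c
    ... | yes d≤c = 1 , 1 , X.above₁ t d t+d≡n d≤J (≰⇒> d≰a) , Y.all t , farkas 0 d≤c (identity k u J c d)
      where
      identity : ∀ k u J c d → suc k * 0 + u + J + c + d ≡ 0 + u * 1 + J * 1 + d + c + 0
      identity = solve-∀
    ... | no d≰c with X.above₂ t d t+d≡n d≤J (≤-trans (s≤s b≤c) (≰⇒> d≰c)) | d ≤? j
    ... | x≤k | yes d≤j = 0 , 1 , x≤k , Y.all t , farkas 0 d≤j (identity k u J c d)
      where
      identity : ∀ k u J c d → suc k * 0 + u + J + c + d ≡ 0 + u * 0 + J * 1 + d + (u + c) + 0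
      identity = solve-∀
    ... | x≤k | no d≰j = 0 , 0 , x≤k , Y.above t d t+d≡n d≤J (≰⇒> d≰j) , farkas (u + c) d≤J (identity k u J c d)
      where
      identity : ∀ k u J c d → suc k * 0 + u + J + c + d ≡ 0 + u * 0 + J * 0 + d + J + (u + c)
      identity = solve-∀

  -- Lengthening the segment by one element lowers `d` by one and adds at most one element of `P`.
  prefix-near : ∀ (P : Subset n) {t d t₀ d₀} → t + d ≡ n → t₀ + d₀ ≡ n → d ≤ d₀ → prefix P t + d ≤ prefix P t₀ + d₀
  prefix-near P {t} {d} {t₀} {d₀} t+d≡n t₀+d₀≡n d≤d₀ = begin
    prefix P t + d                      ≡⟨ cong (λ z → prefix P z + d) t≡ ⟩
    prefix P (t₀ + (d₀ ∸ d)) + d        ≤⟨ +-monoˡ-≤ d (prefix-+ P t₀ (d₀ ∸ d)) ⟩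
    prefix P t₀ + (d₀ ∸ d) + d          ≡⟨ trans (+-assoc (prefix P t₀) _ d) (cong (prefix P t₀ +_) (m∸n+n≡m d≤d₀)) ⟩
    prefix P t₀ + d₀                    ∎
    where
    open ≤-Reasoning
    t≡ : t ≡ t₀ + (d₀ ∸ d)
    t≡ = +-cancelʳ-≡ d t _ (trans t+d≡n (sym (trans (+-assoc t₀ _ d) (trans (cong (t₀ +_) (m∸n+n≡m d≤d₀)) t₀+d₀≡n))))

  -- The number `u` of copies of `X` is chosen to exhaust the budget at `d = 0`, which reads
  -- `∣ P ∣ + u ≤ M`. The budget at `d = 2 * c + 1` is then precisely the hypothesis that `P`
  -- violates `InQ`. Smaller `d ≥ 2` follow by `prefix-near`, larger ones from the copies of `Y`.
  outside-Q : ∀ {P X Y j t₀} → j ≤ 2 * c + 1 → t₀ + (2 * c + 1) ≡ n → ∣ P ∣ + prefix P t₀ < 2 * suc k →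
    P ∈F F → X ∈F F → Y ∈F F → Double k L J 0 1 X → Single k L J j Y → Empty.⊥
  outside-Q {P} {X} {Y} {j} {t₀} j≤2c+1 t₀+d₀≡n P∉Q P∈ X∈ Y∈ double-X single-Y =
    no-mix u (one P P∈) (λ t → ≤-trans (prefix≤size P t) ∣P∣≤M) (m∸n≤m M ∣ P ∣) X∈ Y∈
      (Double.size double-X) (Double.low double-X) (Double.mid double-X) single-Y top
    where
    module X = Double double-X
    module Y = Single single-Y
    near : ∀ {t d} → t + d ≡ n → d ≤ 2 * c + 1 → prefix P t + d ≤ prefix P t₀ + (2 * c + 1)
    near t+d≡n d≤d₀ = prefix-near P t+d≡n t₀+d₀≡n d≤d₀
    ∣P∣-near : ∣ P ∣ ≤ prefix P t₀ + (2 * c + 1)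
    ∣P∣-near = ≤-trans (≤-reflexive (trans (sym (prefix-full P)) (sym (+-identityʳ _)))) (near {n} {0} (+-identityʳ n) z≤n)
    ∣P∣≤M : ∣ P ∣ ≤ M
    -- At most `2 * c + 1` elements of `P` lie beyond `t₀`, so twice the size of `P` is at most
    -- `(2 * suc k - 1) + (2 * c + 1) = 2 * M`.
    ∣P∣≤M = *-cancelˡ-≤ 2 (farkas 0 (+-mono-≤ ∣P∣-near P∉Q) (identity ∣ P ∣ (prefix P t₀) c k))
      where
      identity : ∀ P q c k → 2 * (suc k + c) + (P + suc (P + q)) ≡ 2 * P + (q + (2 * c + 1) + 2 * suc k) + 0
      identity = solve-∀
    u : ℕ
    u = M ∸ ∣ P ∣
    ∣P∣+u≡M : ∣ P ∣ + u ≡ M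
    ∣P∣+u≡M = m+[n∸m]≡n ∣P∣≤M
    top : Top 1 (prefix P) u X Y
    top t zero t+d≡n d≤J = 2 , 1 , X.all t , Y.all t ,
      farkas 0 (+-mono-≤ (prefix≤size P t) (≤-reflexive ∣P∣+u≡M)) (identity (prefix P t) u J k c ∣ P ∣)
      where
      identity : ∀ p u J k c P → suc k * 1 + u + J + c + (p + (P + u)) ≡ p + u * 2 + J * 1 + 0 + (P + (suc k + c)) + 0
      identity = solve-∀
    -- With only rank 0 cut off, copies of `X` meet their quota without any gain. The bounds on `P`
    -- add up to `2 * p + 1 ≤ 2 * M` for `p = prefix P t`, and parity gives `p < M`.
    top t (suc zero) t+d≡n d≤J = 1 , 1 , X.above₁ t 1 t+d≡n d≤J (s≤s z≤n) , Y.all t ,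
      farkas 0 p<M (identity (prefix P t) u J k c)
      where
      near₁ : prefix P t + 1 ≤ prefix P t₀ + (2 * c + 1)
      near₁ = near t+d≡n (m≤n+m 1 (2 * c))
      identity₂ : ∀ p P q c k → 2 * (suc k + c) + (p + 1 + (p + suc (P + q))) ≡ suc (2 * p) + (q + (2 * c + 1) + (P + 2 * suc k)) + 0
      identity₂ = solve-∀
      p<M : prefix P t < M
      p<M = *-cancelˡ-< 2 (prefix P t) M (farkas 0 (+-mono-≤ near₁ (+-mono-≤ (prefix≤size P t) P∉Q)) (identity₂ (prefix P t) ∣ P ∣ (prefix P t₀) c k))
      identity : ∀ p u J k c → suc k * 1 + u + J + c + suc p ≡ p + u * 1 + J * 1 + 1 + (suc k + c) + 0
      identity = solve-∀
    top t d@(suc (suc _)) t+d≡n d≤J with X.above₂ t d t+d≡n d≤J (s≤s (s≤s z≤n)) | d ≤? 2 * c + 1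
    ... | x≤k | yes d≤d₀ = 0 , 1 , x≤k , Y.all t ,
      farkas 0 (+-mono-≤ (near t+d≡n d≤d₀) (+-mono-≤ P∉Q (≤-reflexive (sym ∣P∣+u≡M)))) (identity (prefix P t) ∣ P ∣ (prefix P t₀) u J k c d)
      where
      identity : ∀ p P q u J k c d → suc k * 1 + u + J + c + (p + d + (suc (P + q) + (suc k + c))) ≡
        p + u * 0 + J * 1 + d + (q + (2 * c + 1) + (2 * suc k + (P + u))) + 0
      identity = solve-∀
    ... | x≤k | no d≰d₀ = 0 , 0 , x≤k , Y.above t d t+d≡n d≤J (≤-trans (s≤s j≤2c+1) (≰⇒> d≰d₀)) ,
      farkas u (+-mono-≤ (≤-trans (prefix≤size P t) ∣P∣≤M) d≤J) (identity (prefix P t) u J k c d)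
      where
      identity : ∀ p u J k c d → suc k * 1 + u + J + c + (p + d) ≡ p + u * 0 + J * 0 + d + (suc k + c + J) + u
      identity = solve-∀

  -- At most `k` elements of `P` lie in `[n - 2]`, so `prefix P t + d ≤ k + 2` for `d ≤ 2`, which is
  -- the budget when `c = 1`. For `d > 2` the copies of `Y` pay, as `j ≤ 2`.
  outside-W : ∀ {P Y j t₀} → c ≡ 1 → j ≤ 2 → t₀ + 2 ≡ n → prefix P t₀ < suc k →
    P ∈F F → Y ∈F F → Single k L J j Y → Empty.⊥
  outside-W {P} {Y} {j} {t₀} refl j≤2 t₀+2≡n (s≤s P∉W) P∈ Y∈ single-Y =
    no-mix 0 (one P P∈) p≤M z≤n Y∈ Y∈ size low mid single-Y top
    where
    open Single single-Y
    p≤M : ∀ t → prefix P t ≤ M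
    p≤M t = begin
      prefix P t      ≤⟨ prefix≤size P t ⟩
      ∣ P ∣           ≡⟨ trans (sym (prefix-full P)) (sym (+-identityʳ _)) ⟩
      prefix P n + 0  ≤⟨ prefix-near P (+-identityʳ n) t₀+2≡n z≤n ⟩
      prefix P t₀ + 2 ≤⟨ +-monoˡ-≤ 2 P∉W ⟩
      k + 2           ≡⟨ +-suc k 1 ⟩
      M               ∎
      where open ≤-Reasoning
    top : Top 1 (prefix P) 0 Y Y
    top t d t+d≡n d≤J with d ≤? 2
    ... | yes d≤2 = 1 , 1 , all t , all t ,
      farkas 0 (+-mono-≤ (prefix-near P t+d≡n t₀+2≡n d≤2) P∉W) (identity (prefix P t) (prefix P t₀) J k d)
      where
      identity : ∀ p q J k d → suc k * 1 + 0 + J + 1 + (p + d + q) ≡ p + 0 * 1 + J * 1 + d + (q + 2 + k) + 0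
      identity = solve-∀
    ... | no d≰2 = 1 , 0 , all t , above t d t+d≡n d≤J (≤-trans (s≤s j≤2) (≰⇒> d≰2)) ,
      farkas 0 (+-mono-≤ (p≤M t) d≤J) (identity (prefix P t) J k d)
      where
      identity : ∀ p J k d → suc k * 1 + 0 + J + 1 + (p + d) ≡ p + 0 * 1 + J * 0 + d + (suc k + 1 + J) + 0
      identity = solve-∀

-- Counting missing sets

sumS : ∀ {n} → (Subset n → ℕ) → ℕ
sumS {zero}  f = f []
sumS {suc n} f = sumS (λ X → f (true ∷ X)) + sumS (λ X → f (false ∷ X))

sumS-mono : ∀ {n} {f g : Subset n → ℕ} → (∀ X → f X ≤ g X) → sumS f ≤ sumS g
sumS-mono {zero}  f≤g = f≤g []
sumS-mono {suc n} f≤g = +-mono-≤ (sumS-mono (λ X → f≤g (true ∷ X))) (sumS-mono (λ X → f≤g (false ∷ X)))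

sumS-cong : ∀ {n} {f g : Subset n → ℕ} → (∀ X → f X ≡ g X) → sumS f ≡ sumS g
sumS-cong {zero}  f≡g = f≡g []
sumS-cong {suc n} f≡g = cong₂ _+_ (sumS-cong (λ X → f≡g (true ∷ X))) (sumS-cong (λ X → f≡g (false ∷ X)))

sumS-0 : ∀ n → sumS {n} (λ _ → 0) ≡ 0
sumS-0 zero    = refl
sumS-0 (suc n) = cong₂ _+_ (sumS-0 n) (sumS-0 n)

sumS-+ : ∀ {n} (f g : Subset n → ℕ) → sumS (λ X → f X + g X) ≡ sumS f + sumS g
sumS-+ {zero}  f g = refl
sumS-+ {suc n} f g = trans (cong₂ _+_ (sumS-+ (f ∘ (true ∷_)) (g ∘ (true ∷_))) (sumS-+ (f ∘ (false ∷_)) (g ∘ (false ∷_))))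
  (interchange (sumS (f ∘ (true ∷_))) (sumS (g ∘ (true ∷_))) (sumS (f ∘ (false ∷_))) (sumS (g ∘ (false ∷_))))
  where
  interchange : ∀ a b c d → a + b + (c + d) ≡ a + c + (b + d)
  interchange = solve-∀

sumS-* : ∀ {n} q (f : Subset n → ℕ) → sumS (λ X → q * f X) ≡ q * sumS f
sumS-* {zero}  q f = refl
sumS-* {suc n} q f = trans (cong₂ _+_ (sumS-* q (f ∘ (true ∷_))) (sumS-* q (f ∘ (false ∷_)))) (sym (*-distribˡ-+ q _ _))

term≤sumS : ∀ {n} (f : Subset n → ℕ) X → f X ≤ sumS f
term≤sumS f []          = ≤-refl
term≤sumS f (true ∷ X)  = ≤-trans (term≤sumS (f ∘ (true ∷_)) X) (m≤m+n _ _)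
term≤sumS f (false ∷ X) = ≤-trans (term≤sumS (f ∘ (false ∷_)) X) (m≤n+m _ _)

sumS-++ : ∀ r {J} (f : Subset (r + J) → ℕ) → sumS {r} (λ A → sumS {J} (λ D → f (A ++ D))) ≡ sumS f
sumS-++ zero    f = refl
sumS-++ (suc r) f = cong₂ _+_ (sumS-++ r (f ∘ (true ∷_))) (sumS-++ r (f ∘ (false ∷_)))

sumS-pad : ∀ lo {n} (f : Subset (lo + n) → ℕ) → sumS (λ X → f (pad lo X)) ≤ sumS f
sumS-pad zero     f = ≤-refl
sumS-pad (suc lo) f = ≤-trans (sumS-pad lo (f ∘ (false ∷_))) (m≤n+m _ _)

sumS-block : ∀ {n} lo {r J} (eq : n ≡ lo + (r + J)) (f : Subset n → ℕ) →
  sumS {r} (λ A → sumS {J} (λ D → f (block lo eq A D))) ≤ sumS f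
sumS-block lo {r} refl f = ≤-trans (≤-reflexive (sumS-++ r (λ X → f (pad lo X)))) (sumS-pad lo f)

length-filter-++ : ∀ {A : Set} (f : A → Bool) xs ys → length (filterᵇ f (xs List.++ ys)) ≡ length (filterᵇ f xs) + length (filterᵇ f ys)
length-filter-++ f List.[]       ys = refl
length-filter-++ f (x List.∷ xs) ys with f x
... | true  = cong suc (length-filter-++ f xs ys)
... | false = length-filter-++ f xs ys

length-filter-map : ∀ {A B : Set} (f : B → Bool) (g : A → B) xs → length (filterᵇ f (List.map g xs)) ≡ length (filterᵇ (f ∘ g) xs)
length-filter-map f g List.[]       = refl
length-filter-map f g (x List.∷ xs) with f (g x)
... | true  = cong suc (length-filter-map f g xs)
... | false = length-filter-map f g xs

length-filter-subsets : ∀ n (f : Subset n → Bool) → length (filterᵇ f (allSubsets n)) ≡ sumS (bit ∘ f)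
length-filter-subsets zero f with f []
... | true  = refl
... | false = refl
length-filter-subsets (suc n) f = trans (length-filter-++ f (List.map (true ∷_) (allSubsets n)) (List.map (false ∷_) (allSubsets n)))
  (cong₂ _+_
    (trans (length-filter-map f (true ∷_) (allSubsets n)) (length-filter-subsets n (f ∘ (true ∷_))))
    (trans (length-filter-map f (false ∷_) (allSubsets n)) (length-filter-subsets n (f ∘ (false ∷_)))))

nC0≡1 : ∀ n → n C 0 ≡ 1
nC0≡1 n = trans (nCk≡nC[n∸k] {0} {n} z≤n) (nCn≡1 n)

count-size : ∀ n i → sumS {n} (λ X → bit (∣ X ∣ ≡ᵇ i)) ≡ n C i
count-size zero    zero    = sym (nC0≡1 0)
count-size zero    (suc i) = sym (k>n⇒nCk≡0 {0} {suc i} (s≤s z≤n))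
count-size (suc n) zero    = trans (cong₂ _+_ (sumS-0 n) (count-size n 0)) (trans (nC0≡1 n) (sym (nC0≡1 (suc n))))
count-size (suc n) (suc i) = trans (cong₂ _+_ (count-size n i) (count-size n (suc i))) (nCk+nC[k+1]≡[n+1]C[k+1] n i)

missing : ∀ {n} → Family n → ℕ → Subset n → ℕ
missing F i X = bit ((∣ X ∣ ≡ᵇ i) ∧ not (F X))

-- The sets of size `i` split into present and missing ones, so the truncated subtraction in `y` is
-- exact.
y≡missing : ∀ {n} (F : Family n) i → y F i ≡ sumS (missing F i)
y≡missing {n} F i = trans (cong₂ _∸_ total (length-filter-subsets n (λ P → (∣ P ∣ ≡ᵇ i) ∧ F P))) (m+n∸m≡n present (sumS (missing F i)))
  where
  present : ℕ
  present = sumS (λ X → bit ((∣ X ∣ ≡ᵇ i) ∧ F X))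
  split : ∀ a b → bit (a ∧ b) + bit (a ∧ not b) ≡ bit a
  split true  true  = refl
  split true  false = refl
  split false b     = refl
  total : n C i ≡ present + sumS (missing F i)
  total = trans (sym (count-size n i)) (trans (sym (sumS-cong (λ X → split (∣ X ∣ ≡ᵇ i) (F X)))) (sumS-+ _ (missing F i)))

sumTo : ℕ → (ℕ → ℕ) → ℕ
sumTo zero    f = 0
sumTo (suc n) f = f n + sumTo n f

sumTo-cong : ∀ n {f g : ℕ → ℕ} → (∀ q → q < n → f q ≡ g q) → sumTo n f ≡ sumTo n g
sumTo-cong zero    f≡g = refl
sumTo-cong (suc n) f≡g = cong₂ _+_ (f≡g n ≤-refl) (sumTo-cong n (λ q q<n → f≡g q (m<n⇒m<1+n q<n)))

sumTo-extend : ∀ {m n} (f : ℕ → ℕ) → m ≤ n → sumTo m f ≤ sumTo n f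
sumTo-extend {n = zero}  f z≤n = z≤n
sumTo-extend {n = suc n} f m≤1+n with m≤n⇒m<n∨m≡n m≤1+n
... | inj₁ (s≤s m≤n) = ≤-trans (sumTo-extend f m≤n) (m≤n+m _ (f n))
... | inj₂ refl      = ≤-refl

term≤sumTo : ∀ {q n} (f : ℕ → ℕ) → q < n → f q ≤ sumTo n f
term≤sumTo f q<n = ≤-trans (m≤m+n _ _) (sumTo-extend f q<n)

-- Rank `J` sits at the lowest position. Splitting there puts it and the smaller ranks into
-- different summands of `sumS`, so no set is counted twice.
count-top₁ : ∀ J (h : Subset J → Bool) → sumTo J (λ q → bit (h (top₁ J q))) ≤ sumS (λ D → bit ((∣ D ∣ ≡ᵇ 1) ∧ h D))
count-top₁ zero    h = z≤n
count-top₁ (suc J) h = +-mono-≤ first (≤-trans (≤-reflexive (sumTo-cong J lower)) (count-top₁ J (h ∘ (false ∷_))))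
  where
  first : bit (h (top₁ (suc J) J)) ≤ sumS (λ D → bit ((∣ D ∣ ≡ᵇ 0) ∧ h (true ∷ D)))
  first rewrite ≡ᵇ-refl J = ≤-trans
    (≤-reflexive (cong (λ z → bit ((z ≡ᵇ 0) ∧ h (true ∷ top₁ J J))) (sym (trans (sym (prefix-full (top₁ J J))) (top₁-above J J J ≤-refl)))))
    (term≤sumS (λ D → bit ((∣ D ∣ ≡ᵇ 0) ∧ h (true ∷ D))) (top₁ J J))
  lower : ∀ q → q < J → bit (h (top₁ (suc J) q)) ≡ bit (h (false ∷ top₁ J q))
  lower q q<J rewrite <⇒≡ᵇ-false q J q<J = refl

count-top₂ : ∀ J (h : Subset J → Bool) →
  sumTo J (λ b → sumTo b (λ a → bit (h (top₂ J a b)))) ≤ sumS (λ D → bit ((∣ D ∣ ≡ᵇ 2) ∧ h D))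
count-top₂ zero    h = z≤n
count-top₂ (suc J) h = +-mono-≤ first (≤-trans (≤-reflexive (sumTo-cong J lower)) (count-top₂ J (h ∘ (false ∷_))))
  where
  first : sumTo J (λ a → bit (h (top₂ (suc J) a J))) ≤ sumS (λ D → bit ((∣ D ∣ ≡ᵇ 1) ∧ h (true ∷ D)))
  first rewrite ≡ᵇ-refl J = count-top₁ J (h ∘ (true ∷_))
  lower : ∀ b → b < J → sumTo b (λ a → bit (h (top₂ (suc J) a b))) ≡ sumTo b (λ a → bit (h (false ∷ top₂ J a b)))
  lower b b<J rewrite <⇒≡ᵇ-false b J b<J = refl

≡ᵇ-+ : ∀ k x i → (k + x ≡ᵇ k + i) ≡ (x ≡ᵇ i)
≡ᵇ-+ zero    x i = refl
≡ᵇ-+ (suc k) x i = ≡ᵇ-+ k x i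

module Count {n} (F : Family n) lo {r J} (eq : n ≡ lo + (r + J)) where

  lacks₁ : Subset r → ℕ → ℕ
  lacks₁ A q = bit (not (F (block lo eq A (top₁ J q))))

  lacks₂ : Subset r → ℕ → ℕ → ℕ
  lacks₂ A b a = bit (not (F (block lo eq A (top₂ J a b))))

  lacks : Subset r → ℕ
  lacks A = sumTo J (lacks₁ A) + sumTo J (λ b → sumTo b (lacks₂ A b))

  missing-block : ∀ (A : Subset r) (D : Subset J) i →
    missing F (∣ A ∣ + i) (block lo eq A D) ≡ bit ((∣ D ∣ ≡ᵇ i) ∧ not (F (block lo eq A D)))
  missing-block A D i = cong (λ z → bit (z ∧ not (F (block lo eq A D))))
    (trans (cong (_≡ᵇ ∣ A ∣ + i) (∣block∣ lo eq A D)) (≡ᵇ-+ ∣ A ∣ ∣ D ∣ i))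

  lacks≤missing : ∀ {k} (A : Subset r) → ∣ A ∣ ≡ k →
    lacks A ≤ sumS {J} (λ D → missing F (k + 1) (block lo eq A D) + missing F (k + 2) (block lo eq A D))
  lacks≤missing A refl = ≤-trans
    (+-mono-≤
      (≤-trans (count-top₁ J (λ D → not (F (block lo eq A D)))) (≤-reflexive (sumS-cong {J} (λ D → sym (missing-block A D 1)))))
      (≤-trans (count-top₂ J (λ D → not (F (block lo eq A D)))) (≤-reflexive (sumS-cong {J} (λ D → sym (missing-block A D 2))))))
    (≤-reflexive (sym (sumS-+ {J} (λ D → missing F (∣ A ∣ + 1) (block lo eq A D)) (λ D → missing F (∣ A ∣ + 2) (block lo eq A D)))))

  -- `A` and `D` can be read off from their block, so missing sets found for different `A` are
  -- different.
  many-missing : ∀ k q → (∀ (A : Subset r) → ∣ A ∣ ≡ k → q ≤ lacks A) → q * (r C k) ≤ y F (suc k) + y F (suc k + 1)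
  many-missing k q q≤lacks = begin
    q * (r C k)                                        ≡⟨ cong (q *_) (count-size r k) ⟨
    q * sumS {r} (λ A → bit (∣ A ∣ ≡ᵇ k))              ≡⟨ sumS-* {r} q _ ⟨
    sumS {r} (λ A → q * bit (∣ A ∣ ≡ᵇ k))              ≤⟨ sumS-mono {r} pointwise ⟩
    sumS {r} (λ A → sumS {J} (λ D → both (block lo eq A D))) ≤⟨ sumS-block lo {r} {J} eq both ⟩
    sumS both                                          ≡⟨ sumS-+ (missing F (k + 1)) (missing F (k + 2)) ⟩
    sumS (missing F (k + 1)) + sumS (missing F (k + 2)) ≡⟨ cong₂ _+_ (y≡missing F (k + 1)) (y≡missing F (k + 2)) ⟨
    y F (k + 1) + y F (k + 2)                          ≡⟨ cong₂ (λ a b → y F a + y F b) (+-comm k 1) (+-suc k 1) ⟩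
    y F (suc k) + y F (suc k + 1)                      ∎
    where
    open ≤-Reasoning
    both : Subset n → ℕ
    both X = missing F (k + 1) X + missing F (k + 2) X
    pointwise : ∀ (A : Subset r) → q * bit (∣ A ∣ ≡ᵇ k) ≤ sumS {J} (λ D → both (block lo eq A D))
    pointwise A with ∣ A ∣ ≡ᵇ k in size
    ... | false = ≤-trans (≤-reflexive (*-zeroʳ q)) z≤n
    ... | true = ≤-trans (≤-reflexive (*-identityʳ q)) (≤-trans (q≤lacks A ∣A∣≡k) (lacks≤missing A ∣A∣≡k))
      where
      ∣A∣≡k : ∣ A ∣ ≡ k
      ∣A∣≡k = ≡ᵇ-sound ∣ A ∣ k size

-- All ranks before the first hit are misses, so its position is itself a number of missing sets.
firstHit : ∀ (f : ℕ → Bool) n →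
  (Σ ℕ λ j → j < n × f j ≡ true × sumTo j (λ q → bit (not (f q))) ≡ j) ⊎ (sumTo n (λ q → bit (not (f q))) ≡ n)
firstHit f zero    = inj₂ refl
firstHit f (suc n) with firstHit f n
... | inj₁ (j , j<n , hit , before) = inj₁ (j , m<n⇒m<1+n j<n , hit , before)
... | inj₂ before with f n in eq
...   | true  = inj₁ (n , ≤-refl , eq , before)
...   | false = inj₂ (cong suc before)

-- Estimates for binomial coefficients

C-mono : ∀ n k → n C k ≤ suc n C k
C-mono n zero    = ≤-reflexive (trans (nC0≡1 n) (sym (nC0≡1 (suc n))))
C-mono n (suc k) = ≤-trans (m≤n+m _ (n C k)) (≤-reflexive (nCk+nC[k+1]≡[n+1]C[k+1] n k))

-- Pascal's rule, `e` times, each step adding at most `(x + e) C k`. This bounds the loss from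
-- discarding the `L` lowest and `J` highest elements of `[n]`.
C-grow : ∀ x e k → (x + e) C suc k ≤ x C suc k + e * ((x + e) C k)
C-grow x zero    k = ≤-reflexive (trans (cong (_C suc k) (+-identityʳ x)) (sym (+-identityʳ _)))
C-grow x (suc e) k rewrite +-suc x e = begin
  suc (x + e) C suc k                                    ≡⟨ nCk+nC[k+1]≡[n+1]C[k+1] (x + e) k ⟨
  (x + e) C k + (x + e) C suc k
    ≤⟨ +-mono-≤ up (≤-trans (C-grow x e k) (+-monoʳ-≤ (x C suc k) (*-monoʳ-≤ e up))) ⟩
  suc (x + e) C k + (x C suc k + e * (suc (x + e) C k)) ≡⟨ swap (suc (x + e) C k) (x C suc k) e ⟩
  x C suc k + suc e * (suc (x + e) C k)                 ∎
  where
  open ≤-Reasoning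
  up : (x + e) C k ≤ suc (x + e) C k
  up = C-mono (x + e) k
  swap : ∀ a b e → a + (b + e * a) ≡ b + suc e * a
  swap = solve-∀

C≤^ : ∀ n k → n C k ≤ n ^ k
C≤^ n       zero    = ≤-reflexive (nC0≡1 n)
C≤^ zero    (suc k) = ≤-reflexive (k>n⇒nCk≡0 {0} {suc k} (s≤s z≤n))
C≤^ (suc n) (suc k) = begin
  suc n C suc k         ≡⟨ nCk+nC[k+1]≡[n+1]C[k+1] n k ⟨
  n C k + n C suc k     ≤⟨ +-mono-≤ (C≤^ n k) (C≤^ n (suc k)) ⟩
  suc n * n ^ k         ≤⟨ *-monoʳ-≤ (suc n) (^-monoˡ-≤ k (n≤1+n n)) ⟩
  suc n * suc n ^ k     ∎
  where open ≤-Reasoning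

absorption : ∀ n k → suc k * (suc n C suc k) ≡ suc n * (n C k)
absorption n       zero    = trans (+-identityʳ _) (trans (nC1≡n (suc n)) (sym (trans (cong (suc n *_) (nC0≡1 n)) (*-identityʳ (suc n)))))
absorption zero    (suc k) = trans (cong (suc (suc k) *_) (k>n⇒nCk≡0 {1} {suc (suc k)} (s≤s (s≤s z≤n))))
  (trans (*-zeroʳ k) (sym (cong (1 *_) (k>n⇒nCk≡0 {0} {suc k} (s≤s z≤n)))))
absorption (suc n) (suc k) = begin
  suc (suc k) * (suc (suc n) C suc (suc k))
    ≡⟨ cong (suc (suc k) *_) (nCk+nC[k+1]≡[n+1]C[k+1] (suc n) (suc k)) ⟨
  suc (suc k) * (suc n C suc k + suc n C suc (suc k))                ≡⟨ expand (suc k) (suc n C suc k) _ ⟩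
  suc n C suc k + (suc k * (suc n C suc k) + suc (suc k) * (suc n C suc (suc k)))
    ≡⟨ cong (suc n C suc k +_) (cong₂ _+_ (absorption n k) (absorption n (suc k))) ⟩
  suc n C suc k + (suc n * (n C k) + suc n * (n C suc k))
    ≡⟨ cong (suc n C suc k +_) (*-distribˡ-+ (suc n) (n C k) _) ⟨
  suc n C suc k + suc n * (n C k + n C suc k)
    ≡⟨ cong (λ z → suc n C suc k + suc n * z) (nCk+nC[k+1]≡[n+1]C[k+1] n k) ⟩
  suc (suc n) * (suc n C suc k)                                      ∎
  where
  open ≡-Reasoning
  expand : ∀ k a b → suc k * (a + b) ≡ a + (k * a + suc k * b)
  expand = solve-∀

-- By `absorption` the two numerators compare factor by factor: at most `B * x` on the left, at
-- least `x` on the right. Thus a window of length proportional to `n` contains a fixed proportion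
-- of all `k`-sets.
C-ratio : ∀ B x n k → n ≤ B * x → n C k ≤ B ^ k * ((x + k) C k)
C-ratio B x n       zero    n≤Bx = ≤-reflexive (trans (nC0≡1 n) (sym (trans (+-identityʳ _) (nC0≡1 (x + 0)))))
C-ratio B x zero    (suc k) n≤Bx = ≤-trans (≤-reflexive (k>n⇒nCk≡0 {0} {suc k} (s≤s z≤n))) z≤n
C-ratio B x (suc n) (suc k) n<Bx rewrite +-suc x k = *-cancelˡ-≤ (suc k) (begin
  suc k * (suc n C suc k)                          ≡⟨ absorption n k ⟩
  suc n * (n C k)                                  ≤⟨ *-mono-≤ n<Bx (C-ratio B x n k (<⇒≤ n<Bx)) ⟩
  B * x * (B ^ k * ((x + k) C k))                  ≤⟨ *-monoˡ-≤ _ (*-monoʳ-≤ B (≤-trans (m≤m+n x k) (n≤1+n _))) ⟩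
  B * suc (x + k) * (B ^ k * ((x + k) C k))        ≡⟨ regroup B (suc (x + k)) (B ^ k) ((x + k) C k) ⟩
  B * B ^ k * (suc (x + k) * ((x + k) C k))        ≡⟨ cong (B * B ^ k *_) (absorption (x + k) k) ⟨
  B * B ^ k * (suc k * (suc (x + k) C suc k))      ≡⟨ swap (B * B ^ k) (suc k) _ ⟩
  suc k * (B * B ^ k * (suc (x + k) C suc k))      ∎)
  where
  open ≤-Reasoning
  regroup : ∀ B x p c → B * x * (p * c) ≡ B * p * (x * c)
  regroup = solve-∀
  swap : ∀ a b c → a * (b * c) ≡ b * (a * c)
  swap = solve-∀

-- A negated inclusion yields a witness constructively, by search through the finitely many subsets.
find-outside : ∀ {n} (F : Family n) {G : Subset n → Set} → (∀ P → Dec (G P)) → ¬ FamSub F G →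
  Σ (Subset n) λ P → P ∈F F × ¬ G P
find-outside F G? F⊈G with anySubset? (λ P → (F P Bool.≟ true) ×-dec ¬? (G? P))
... | yes found = found
... | no  none′ = ⊥-elim (F⊈G λ P P∈F → decidable-stable (G? P) λ ¬GP → none′ (P , P∈F , ¬GP))

-- Missing extensions of a single `k`-set

module _ {n k c s J L q₀ r : ℕ} (0<k : 0 < k) (F : Family n) (shifted : Shifted F) (ν : νLess F s)
  (n≡ : n ≡ suc k * s + c) (L-large : suc k + c + (suc k + c + J) * k ≤ L) (s-large : suc (suc k + c + J) ≤ s)
  {Z : Subset n} (Z∈ : Z ∈F F) (single-Z : Single k (k * s + L) J q₀ Z)
  (J-large : 2 * c + 2 ≤ J) (eq : n ≡ L + (r + J)) where

  open Configuration F shifted ν n≡ L-large s-large Z∈ single-Z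
  open Count F L {r} {J} eq

  ExceedsW : Set
  ExceedsW = Σ (Subset n) λ P → P ∈F F × Σ ℕ λ t → t + 2 ≡ n × prefix P t < suc k

  enough-missing : ∀ {P t₀} → P ∈F F → t₀ + (2 * c + 1) ≡ n → ∣ P ∣ + prefix P t₀ < 2 * suc k →
    2 ≤ c ⊎ (c ≡ 1 × ExceedsW) → ∀ A → ∣ A ∣ ≡ k → 2 * c + 2 ≤ lacks A
  enough-missing P∈ t₀≡ P∉Q c-case A ∣A∣≡k with firstHit (λ q → F (block L eq A (top₁ J q))) J
  ... | inj₂ none-hit = ≤-trans J-large (≤-trans (≤-reflexive (sym none-hit)) (m≤m+n _ _))
  ... | inj₁ (j , j<J , Y∈ , j-missing) with 2 * c + 2 ≤? j | j ≤? c
  ... | yes 2c+2≤j | _ = ≤-trans 2c+2≤j (≤-trans (≤-reflexive (sym j-missing)) (≤-trans (sumTo-extend _ (<⇒≤ j<J)) (m≤m+n _ _)))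
  ... | no _ | yes j≤c = ⊥-elim (low-single j≤c Y∈ (block-single L eq A j ∣A∣≡k 0<k))
  ... | no 2c+2≰j | no j≰c = result
    where
    j≤2c+1 : j ≤ 2 * c + 1
    j≤2c+1 = +-cancelʳ-≤ 1 j (2 * c + 1) (≤-trans (≤-reflexive (+-comm j 1)) (≤-trans (≰⇒> 2c+2≰j) (≤-reflexive (sym (+-assoc (2 * c) 1 1)))))
    c<j : c < j
    c<j = ≰⇒> j≰c
    single-Y : Single k L J j (block L eq A (top₁ J j))
    single-Y = block-single L eq A j ∣A∣≡k 0<k
    pairs : ℕ → ℕ
    pairs b = sumTo b (lacks₂ A b)
    pairs₁ : 1 ≤ pairs 1
    pairs₁ with F (block L eq A (top₂ J 0 1)) in X∈
    ... | true  = ⊥-elim (outside-Q j≤2c+1 t₀≡ P∉Q P∈ X∈ Y∈ (block-double L eq A 0 1 ∣A∣≡k 0<k) single-Y)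
    ... | false = s≤s z≤n
    j≤singles : j ≤ sumTo J (lacks₁ A)
    j≤singles = ≤-trans (≤-reflexive (sym j-missing)) (sumTo-extend _ (<⇒≤ j<J))
    second : 2 ≤ c ⊎ (c ≡ 1 × ExceedsW) → j ≤ 2 * c → 2 * c + 2 ≤ lacks A
    second (inj₂ (c≡1 , P , P∈′ , t , t+2≡n , P∉W)) j≤2c =
      ⊥-elim (outside-W c≡1 (≤-trans j≤2c (≤-reflexive (cong (2 *_) c≡1))) t+2≡n P∉W P∈′ Y∈ single-Y)
    -- The pairs of ranks `a ≤ 2 * c - j` and `c` are those refuted by `low-double`, so all
    -- `2 * c - j + 1` of them are missing.
    second (inj₁ 2≤c) j≤2c with firstHit (λ a → F (block L eq A (top₂ J a c))) (suc (2 * c ∸ j))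
    ... | inj₁ (a , s≤s a≤2c∸j , X∈ , _) =
      ⊥-elim (low-double (j ∸ c) (m∸n+n≡m (<⇒≤ c<j)) a+j≤2c ≤-refl X∈ Y∈ (block-double L eq A a c ∣A∣≡k 0<k) single-Y)
      where
      a+j≤2c : a + j ≤ c + c
      a+j≤2c = ≤-trans (+-monoˡ-≤ j a≤2c∸j) (≤-trans (≤-reflexive (m∸n+n≡m j≤2c)) (≤-reflexive (cong (c +_) (+-identityʳ c))))
    ... | inj₂ none-hit = begin
      2 * c + 2                               ≡⟨ cong (_+ 2) (m+[n∸m]≡n j≤2c) ⟨
      j + (2 * c ∸ j) + 2                     ≡⟨ regroup j (2 * c ∸ j) ⟩
      j + (suc (2 * c ∸ j) + 1)
        -- `2 ≤ c` separates the row `b = 1`, with the pair of ranks 0 and 1, from the row `b = c`.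
        ≤⟨ +-mono-≤ j≤singles (+-mono-≤ pairs-c (≤-trans pairs₁ (term≤sumTo pairs 2≤c))) ⟩
      sumTo J (lacks₁ A) + sumTo (suc c) pairs ≤⟨ +-monoʳ-≤ _ (sumTo-extend pairs c<J) ⟩
      lacks A                                 ∎
      where
      open ≤-Reasoning
      regroup : ∀ j x → j + x + 2 ≡ j + (suc x + 1)
      regroup = solve-∀
      c<J : c < J
      c<J = ≤-trans c<j (<⇒≤ j<J)
      pairs-c : suc (2 * c ∸ j) ≤ pairs c
      -- Row `c` contains all these pairs: `c < j` gives `2 * c - j < c`.
      pairs-c = ≤-trans (≤-reflexive (sym none-hit)) (sumTo-extend (lacks₂ A c)
        (+-cancelʳ-≤ j _ c (begin
          suc (2 * c ∸ j) + j ≡⟨ cong suc (m∸n+n≡m j≤2c) ⟩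
          suc (2 * c)         ≡⟨ cong suc (cong (c +_) (+-identityʳ c)) ⟩
          suc (c + c)         ≡⟨ +-suc c c ⟨
          c + suc c           ≤⟨ +-monoʳ-≤ c c<j ⟩
          c + j               ∎)))
    result : 2 * c + 2 ≤ lacks A
    result with j ≤? 2 * c
    -- Now `j = 2 * c + 1`, and the pair of ranks 0 and 1 supplies the one set that the singles
    -- leave open.
    ... | no j≰2c = begin
      2 * c + 2               ≡⟨ +-suc (2 * c) 1 ⟩
      suc (2 * c + 1)         ≡⟨ +-comm 1 (2 * c + 1) ⟩
      2 * c + 1 + 1           ≡⟨ cong (_+ 1) (+-comm (2 * c) 1) ⟩
      suc (2 * c) + 1         ≤⟨ +-mono-≤ (≤-trans (≰⇒> j≰2c) j≤singles) (≤-trans pairs₁ (term≤sumTo pairs 1<J)) ⟩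
      lacks A                 ∎
      where
      open ≤-Reasoning
      1<J : 1 < J
      1<J = ≤-trans (m≤n+m 2 (2 * c)) J-large
    ... | yes j≤2c = second c-case j≤2c

-- Constants and the final estimate

^-distribʳ-* : ∀ k a b → (a * b) ^ k ≡ a ^ k * b ^ k
^-distribʳ-* zero    a b = refl
^-distribʳ-* (suc k) a b = trans (cong (a * b *_) (^-distribʳ-* k a b)) (interchange a b (a ^ k) (b ^ k))
  where
  interchange : ∀ a b c d → a * b * (c * d) ≡ a * c * (b * d)
  interchange = solve-∀

module Bound {n k′ c s M J L : ℕ} (M≡ : M ≡ suc (suc k′) + c) (J≡ : J ≡ (2 * c + 2) * (2 * M) ^ suc k′)
  (L-large : M + (M + J) * suc k′ ≤ L) (s-large : suc (M + J) ≤ s) (2W≤s : 2 * (suc k′ + L + J) ≤ s) (n≡ : n ≡ suc (suc k′) * s + c)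
  (F : Family n) (shifted : Shifted F) (ν : νLess F s) where

  k : ℕ
  k = suc k′

  B W x r₁ : ℕ
  B = 2 * M
  W = k + L + J
  -- The window `(k * s + L, n - J]` has `x + k` elements, the form that `C-ratio` expects.
  x = s + c ∸ W
  r₁ = n ∸ (L + J)

  J-large : 2 * c + 2 ≤ J
  J-large = ≤-trans (≤-trans (≤-reflexive (sym (*-identityʳ _))) (*-monoʳ-≤ (2 * c + 2) (B^>0 M≡))) (≤-reflexive (sym J≡))
    where
    B^>0 : M ≡ suc k + c → 0 < B ^ k
    B^>0 refl = m^n>0 B k
  W≤s : W ≤ s
  W≤s = ≤-trans (m≤m+n W _) 2W≤s
  s≤n : s ≤ n
  s≤n = ≤-trans (m≤m+n s (k * s)) (≤-trans (m≤m+n _ c) (≤-reflexive (sym n≡)))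
  x+W≡ : x + W ≡ s + c
  x+W≡ = m∸n+n≡m (≤-trans W≤s (m≤m+n s c))

  n≡₁ : r₁ + (L + J) ≡ n
  n≡₁ = m∸n+n≡m (≤-trans (m≤n+m (L + J) k) (≤-trans (≤-reflexive (sym (+-assoc k L J))) (≤-trans W≤s s≤n)))

  eq₁ : n ≡ L + (r₁ + J)
  eq₁ = trans (sym n≡₁) (swap r₁ L J)
    where
    swap : ∀ r L J → r + (L + J) ≡ L + (r + J)
    swap = solve-∀

  eq₀ : n ≡ (k * s + L) + ((x + k) + J)
  eq₀ = begin
    n                             ≡⟨ n≡ ⟩
    suc k * s + c                 ≡⟨ front k s c ⟩
    k * s + (s + c)               ≡⟨ cong (k * s +_) x+W≡ ⟨
    k * s + (x + (k + L + J))     ≡⟨ back (k * s) x k L J ⟩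
    (k * s + L) + ((x + k) + J)   ∎
    where
    open ≡-Reasoning
    front : ∀ k s c → suc k * s + c ≡ k * s + (s + c)
    front = solve-∀
    back : ∀ a x k L J → a + (x + (k + L + J)) ≡ (a + L) + ((x + k) + J)
    back = solve-∀

  n≤Ms : n ≤ M * s
  n≤Ms = begin
    n                   ≡⟨ n≡ ⟩
    suc k * s + c
      ≤⟨ +-monoʳ-≤ (suc k * s) (≤-trans (≤-reflexive (sym (*-identityʳ c))) (*-monoʳ-≤ c (≤-trans (s≤s z≤n) s-large))) ⟩
    suc k * s + c * s   ≡⟨ *-distribʳ-+ s (suc k) c ⟨
    (suc k + c) * s     ≡⟨ cong (_* s) M≡ ⟨
    M * s               ∎
    where open ≤-Reasoning

  n≤Bx : n ≤ B * x
  n≤Bx = begin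
    n           ≤⟨ n≤Ms ⟩
    -- `2 * W ≤ s` makes `x` at least half of `s`.
    M * s       ≤⟨ *-monoʳ-≤ M (farkas (2 * c) (+-mono-≤ 2W≤s (*-monoʳ-≤ 2 (≤-reflexive (sym x+W≡)))) (identity x W s c)) ⟩
    M * (2 * x) ≡⟨ trans (sym (*-assoc M 2 x)) (cong (_* x) (*-comm M 2)) ⟩
    B * x       ∎
    where
    open ≤-Reasoning
    identity : ∀ x W s c → 2 * x + (2 * W + 2 * (s + c)) ≡ s + (s + 2 * (x + W)) + 2 * c
    identity = solve-∀

  K′ : ℕ
  K′ = (2 * c + 2) * ((L + J) * M ^ k′)

  missing-sum : ℕ
  missing-sum = y F (suc k) + y F (suc k + 1)

  Low : Subset (x + k) → Set
  Low A = ∣ A ∣ ≡ k × Σ ℕ λ q → q < J × F (block (k * s + L) eq₀ A (top₁ J q)) ≡ true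

  low? : ∀ A → Dec (Low A)
  low? A = (∣ A ∣ ≟ k) ×-dec anyUpTo? (λ q → F (block (k * s + L) eq₀ A (top₁ J q)) Bool.≟ true) J

  -- Every `k`-set of the upper window lacks all `J` extensions by one top element, and `J` contains
  -- the factor `B ^ k` that `C-ratio` loses.
  all-high : ¬ Σ (Subset (x + k)) Low → (2 * c + 2) * (n C k) ≤ missing-sum
  all-high no-low = begin
    (2 * c + 2) * (n C k)                       ≤⟨ *-monoʳ-≤ (2 * c + 2) (C-ratio B x n k n≤Bx) ⟩
    (2 * c + 2) * (B ^ k * ((x + k) C k))
      ≡⟨ trans (sym (*-assoc (2 * c + 2) (B ^ k) ((x + k) C k))) (cong (_* ((x + k) C k)) (sym J≡)) ⟩
    J * ((x + k) C k)                           ≤⟨ many-missing k J J≤lacks ⟩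
    missing-sum                                 ∎
    where
    open ≤-Reasoning
    open Count F (k * s + L) {x + k} {J} eq₀
    J≤lacks : ∀ A → ∣ A ∣ ≡ k → J ≤ lacks A
    J≤lacks A ∣A∣≡k with firstHit (λ q → F (block (k * s + L) eq₀ A (top₁ J q))) J
    ... | inj₁ (q , q<J , hit , _) = ⊥-elim (no-low (A , ∣A∣≡k , q , q<J , hit))
    ... | inj₂ none-hit            = ≤-trans (≤-reflexive (sym none-hit)) (m≤m+n _ _)

  nCk-bound : (2 * c + 2) * (n C k) ≤ (2 * c + 2) * (r₁ C k) + suc K′ * s ^ k′
  nCk-bound = begin
    (2 * c + 2) * (n C k)                                            ≡⟨ cong (λ z → (2 * c + 2) * (z C k)) n≡₁ ⟨
    (2 * c + 2) * ((r₁ + (L + J)) C k)                               ≤⟨ *-monoʳ-≤ (2 * c + 2) (C-grow r₁ (L + J) k′) ⟩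
    (2 * c + 2) * (r₁ C k + (L + J) * ((r₁ + (L + J)) C k′))
      ≡⟨ cong (λ z → (2 * c + 2) * (r₁ C k + (L + J) * (z C k′))) n≡₁ ⟩
    (2 * c + 2) * (r₁ C k + (L + J) * (n C k′))
      ≤⟨ *-monoʳ-≤ (2 * c + 2) (+-monoʳ-≤ (r₁ C k) (*-monoʳ-≤ (L + J) nCk′≤)) ⟩
    (2 * c + 2) * (r₁ C k + (L + J) * (M ^ k′ * s ^ k′))
      ≡⟨ regroup (2 * c + 2) (r₁ C k) (L + J) (M ^ k′) (s ^ k′) ⟩
    (2 * c + 2) * (r₁ C k) + (2 * c + 2) * ((L + J) * M ^ k′) * s ^ k′
      -- Passing to `suc K′` makes the constant of the theorem visibly positive.
      ≤⟨ +-monoʳ-≤ ((2 * c + 2) * (r₁ C k)) (m≤n+m _ (s ^ k′)) ⟩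
    (2 * c + 2) * (r₁ C k) + suc K′ * s ^ k′                              ∎
    where
    open ≤-Reasoning
    regroup : ∀ q C e M S → q * (C + e * (M * S)) ≡ q * C + q * (e * M) * S
    regroup = solve-∀
    nCk′≤ : n C k′ ≤ M ^ k′ * s ^ k′
    nCk′≤ = ≤-trans (C≤^ n k′) (≤-trans (^-monoˡ-≤ k′ n≤Ms) (≤-reflexive (^-distribʳ-* k′ M s)))

  bound : ¬ FamSub F (InQ (suc k) s c) → 2 ≤ c ⊎ (c ≡ 1 × ¬ FamSub F (InW (suc k) s)) →
    (2 * c + 2) * (n C k) ≤ missing-sum + suc K′ * s ^ k′
  bound F⊈Q c-case with anySubset? low?
  ... | no no-low = ≤-trans (all-high no-low) (m≤m+n _ _)
  ... | yes (A₀ , ∣A₀∣≡k , q₀ , q₀<J , Z∈) = ≤-trans nCk-bound (+-monoˡ-≤ (suc K′ * s ^ k′)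
    (Count.many-missing F L {r₁} {J} eq₁ k (2 * c + 2)
      (enough-missing (s≤s z≤n) F shifted ν n≡
          (subst (λ M → M + (M + J) * k ≤ L) M≡ L-large) (subst (λ M → suc (M + J) ≤ s) M≡ s-large)
          Z∈ (block-single (k * s + L) eq₀ A₀ q₀ ∣A₀∣≡k (s≤s z≤n))
        J-large eq₁ P∈ t₀≡ P∉Q′ (c-case′ c-case))))
    where
    outside : Σ (Subset n) λ P → P ∈F F × ¬ InQ (suc k) s c P
    outside = find-outside F (λ P → 2 * suc k ≤? _) F⊈Q
    P : Subset n
    P = proj₁ outside
    P∈ : P ∈F F
    P∈ = proj₁ (proj₂ outside)
    -- Makes the truncated subtractions in `InQ` and `InW` exact.
    c<ms : suc c ≤ suc k * s
    c<ms = ≤-trans (≤-trans (s≤s (≤-trans (≤-trans (m≤n+m c (suc k)) (≤-reflexive (sym M≡))) (m≤m+n M J))) s-large) (m≤m+n s (k * s))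
    t₀≡ : suc k * s ∸ c ∸ 1 + (2 * c + 1) ≡ n
    t₀≡ = begin
      suc k * s ∸ c ∸ 1 + (2 * c + 1)
        ≡⟨ cong (_+ (2 * c + 1)) (trans (∸-+-assoc (suc k * s) c 1) (cong (suc k * s ∸_) (+-comm c 1))) ⟩
      suc k * s ∸ suc c + (2 * c + 1)     ≡⟨ regroup (suc k * s ∸ suc c) c ⟩
      suc k * s ∸ suc c + suc c + c       ≡⟨ cong (_+ c) (m∸n+n≡m c<ms) ⟩
      suc k * s + c                       ≡⟨ n≡ ⟨
      n                                   ∎
      where
      open ≡-Reasoning
      regroup : ∀ a c → a + (2 * c + 1) ≡ a + suc c + c
      regroup = solve-∀
    P∉Q′ : ∣ P ∣ + prefix P (suc k * s ∸ c ∸ 1) < 2 * suc k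
    P∉Q′ = subst (λ z → ∣ P ∣ + z < 2 * suc k) (∣∩seg∣ P _) (≰⇒> (proj₂ (proj₂ outside)))
    c-case′ : 2 ≤ c ⊎ (c ≡ 1 × ¬ FamSub F (InW (suc k) s)) →
      2 ≤ c ⊎ (c ≡ 1 × Σ (Subset n) λ P → P ∈F F × Σ ℕ λ t → t + 2 ≡ n × prefix P t < suc k)
    c-case′ (inj₁ 2≤c) = inj₁ 2≤c
    c-case′ (inj₂ (c≡1 , F⊈W)) with find-outside F (λ P → suc k ≤? _) F⊈W
    ... | P′ , P′∈ , P′∉W = inj₂ (c≡1 , P′ , P′∈ , suc k * s ∸ 1 , t+2≡n ,
      subst (_< suc k) (∣∩seg∣ P′ _) (≰⇒> P′∉W))
      where
      t+2≡n : suc k * s ∸ 1 + 2 ≡ n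
      t+2≡n = begin
        suc k * s ∸ 1 + 2     ≡⟨ +-assoc (suc k * s ∸ 1) 1 1 ⟨
        suc k * s ∸ 1 + 1 + 1 ≡⟨ cong (_+ 1) (m∸n+n≡m (≤-trans (s≤s z≤n) c<ms)) ⟩
        suc k * s + 1         ≡⟨ cong (suc k * s +_) c≡1 ⟨
        suc k * s + c         ≡⟨ n≡ ⟨
        n                     ∎
        where open ≡-Reasoning

theorem2 : (m c : ℕ) → 2 ≤ m → 1 ≤ c →
    Σ ℕ λ K → Σ ℕ λ s₀ → (0 < K) × (0 < s₀) ×
    ((s : ℕ) → s₀ ≤ s → (F : Family (m * s + c)) →
    Shifted F → νLess F s →
    ((2 ≤ c × ¬ FamSub F (InQ m s c))
    ⊎ (c ≡ 1 × ¬ FamSub F (InQ m s c) × ¬ FamSub F (InW m s))) →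
    (2 * c + 2) * ((m * s + c) C (m ∸ 1)) ≤ y F m + y F (m + 1) + K * s ^ (m ∸ 2))
-- In the threshold for `s`, the first summand gives `n ≤ B * x`; the second reserves room in the
-- matching for `P`, up to `M` copies of `X` and `J` copies of `Y`.
theorem2 (suc (suc k′)) c _ _ = suc ((2 * c + 2) * ((L + J) * M ^ k′)) , 2 * (suc k′ + L + J) + suc (M + J) ,
  s≤s z≤n , ≤-trans (s≤s z≤n) (m≤n+m (suc (M + J)) (2 * (suc k′ + L + J))) ,
  λ s s₀≤s F shifted ν cases →
    Bound.bound {M = M} {J} {L} refl refl ≤-refl
      (≤-trans (m≤n+m (suc (M + J)) (2 * (suc k′ + L + J))) s₀≤s) (≤-trans (m≤m+n _ (suc (M + J))) s₀≤s) refl F shifted ν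
      (proj₁ (split cases)) (proj₂ (split cases))
  where
  M J L : ℕ
  M = suc (suc k′) + c
  J = (2 * c + 2) * (2 * M) ^ suc k′
  -- Below the top `J` elements, `P` has at most `M` elements and each of the at most `M + J` copies
  -- of `X` and `Y` at most `suc k′`.
  L = M + (M + J) * suc k′
  split : ∀ {A B C D : Set} → (A × B) ⊎ (C × B × D) → B × (A ⊎ (C × D))
  split (inj₁ (a , b))     = b , inj₁ a
  split (inj₂ (c , b , d)) = b , inj₂ (c , d)
theorem2 (suc zero) c (s≤s ()) 1≤c
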